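{- Let $P,Q,P',Q'$ be integers and $M=\begin{pmatrix}P&P'\\Q&Q'\end{pmatrix}$. For each $x\in\Omega=[0,1]\setminus\mathbb Q$ the following are equivalent: (i) $P/Q$, $P'/Q'$ are successive convergents in $\mathrm{OCF}(x)$. (ii) $M\in\mathcal R_O$ and one of the following two conditions holds: ($\ast$) $\lambda_M>2+g$ and $0<|E_M(x)|<1$; ($\ast\ast$) $g<\lambda_M\leqslant2+g$ and $0<E_M(x)<1$.
   Context: Here $g=(\sqrt5-1)/2$. OCF expansion. Let $\mathbb N=\{1,2,\dots\}$, $D=\bigcup_{n\in 2\mathbb N}[\frac1{n+1},\frac1n)$. For $x\in\Omega$ put $e_D(x)=1$, $a_D(x)=[1/x]$, $T_D(x)=\{1/x\}$ if $x\notin D$, and $e_D(x)=-1$, $a_D(x)=1+[1/x]$, $T_D(x)=1-\{1/x\}$ if $x\in D$ (integer and fractional parts $[\cdot]$, $\{\cdot\}$). For $x\in\Omega$ set $t_n=T_D^n(x)$, $e_0=1$, and for $n\ge1$: $e_n=e_D(t_{n-1})$, $a_n=a_D(t_{n-1})$ (all $a_n$ are odd positive integers with $a_n+e_n\ge2$). The convergents $p_n/q_n$ of $\mathrm{OCF}(x)$ are given by $p_{ -1}=1$, $p_0=0$, $p_n=a_np_{n-1}+e_{n-1}p_{n-2}$, $q_{ -1}=0$, $q_0=1$, $q_n=a_nq_{n-1}+e_{n-1}q_{n-2}$ for $n\ge1$. "$P/Q,P'/Q'$ are successive convergents in $\mathrm{OCF}(x)$" means that $P=p_{n-1}$, $Q=q_{n-1}$,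 $P'=p_n$, $Q'=q_n$ for some $n\ge1$. Let $I=\begin{pmatrix}1&0\\0&1\end{pmatrix}$, $A=\begin{pmatrix}0&1\\1&1\end{pmatrix}$, $B=\begin{pmatrix}1&1\\1&0\end{pmatrix}$. For $M=\begin{pmatrix}P&P'\\Q&Q'\end{pmatrix}$ put $\lambda_M=Q'/Q$ and, for $x\notin\mathbb Q$, $E_M(x)=\dfrac{Q'x-P'}{ -Qx+P}$. $\mathcal R_O$ is the set of $M\in\mathrm{GL}_2(\mathbb Z)$ with $0\leqslant P\leqslant Q$, $1\leqslant P'\leqslant Q'$, $\lambda_M>g$, and $M\equiv I$, $A$ or $B\pmod2$ (entrywise). -}

module Defs where

open import Level using (suc) renaming (_⊔_ to _⊔ˡ_)
open import Algebra.Apartness.Bundles using (HeytingField)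
open import Algebra.Apartness.Structures using (IsHeytingField)
open import Algebra.Bundles using (CommutativeRing)
open import Algebra.Core using (Op₁; Op₂)
open import Algebra.Definitions using (Invertible)
open import Algebra.Solver.Ring.AlmostCommutativeRing using (AlmostCommutativeRing; fromCommutativeRing; _-Raw-AlmostCommutative⟶_)
open import Data.Empty using (⊥-elim)
open import Data.Integer.Base using (ℤ; +_; -[1+_]; 0ℤ; 1ℤ; -1ℤ; _⊖_) renaming (_+_ to _+ᶻ_; _*_ to _*ᶻ_; -_ to -ᶻ_; _-_ to _-ᶻ_; _≤_ to _≤ᶻ_)
open import Data.Integer.Divisibility using () renaming (_∣_ to _∣ᶻ_)
open import Data.Maybe.Base using (Maybe; just; nothing)
open import Data.Nat.Base as ℕ using (ℕ; zero; NonZero)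
open import Data.Nat.Divisibility using (_∣_; _∣?_)
open import Data.Product.Base using (∃; ∃-syntax; Σ-syntax; _×_; _,_; proj₁; proj₂)
open import Data.Sum.Base using (_⊎_; inj₁; inj₂; [_,_]′)
open import Function.Base using (_∘_)
open import Relation.Binary.Core using (Rel)
open import Relation.Binary.Definitions using (Cotransitive)
open import Relation.Binary.Lattice.Definitions using (Supremum)
open import Relation.Binary.PropositionalEquality.Core as ≡ using (_≡_; _≢_)
open import Relation.Binary.Structures using (IsStrictPartialOrder)
open import Relation.Nullary using (¬_; Dec; yes; no)
open import Relation.Nullary.Decidable.Core using (map′)
open import Relation.Unary using (Pred)
import Algebra.Apartness.Properties.HeytingCommutativeRing as HeytingProperties
import Algebra.Definitions.RawMonoid as RawMonoidDefinitions
import Algebra.Properties.Ring as RingProperties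
import Algebra.Properties.Semiring.Mult.TCOptimised as Mult
import Algebra.Solver.Ring as RingSolver
import Data.Integer.Properties as ℤ
import Data.Nat.Properties as ℕ
import Relation.Binary.Reasoning.Setoid as SetoidReasoning

-- The matrix with rows (P  P′) and (Q  Q′).
record Matrix : Set where
  constructor matrix
  field
    P P′ Q Q′ : ℤ

I A B : Matrix
I = matrix 1ℤ 0ℤ 0ℤ 1ℤ
A = matrix 0ℤ 1ℤ 1ℤ 1ℤ
B = matrix 1ℤ 1ℤ 1ℤ 0ℤ

infixl 7 _⊗_
_⊗_ : Op₂ Matrix
matrix a b c d ⊗ matrix a′ b′ c′ d′ =
  matrix (a *ᶻ a′ +ᶻ b *ᶻ c′) (a *ᶻ b′ +ᶻ b *ᶻ d′)
         (c *ᶻ a′ +ᶻ d *ᶻ c′) (c *ᶻ b′ +ᶻ d *ᶻ d′)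

_∈GL₂[ℤ] : Pred Matrix _
M ∈GL₂[ℤ] = Invertible _≡_ I _⊗_ M

_≡ᴹ_[mod2] : Rel Matrix _
M ≡ᴹ N [mod2] = + 2 ∣ᶻ M.P -ᶻ N.P × + 2 ∣ᶻ M.P′ -ᶻ N.P′ × + 2 ∣ᶻ M.Q -ᶻ N.Q × + 2 ∣ᶻ M.Q′ -ᶻ N.Q′
  where
  module M = Matrix M
  module N = Matrix N

column≢0 : ∀ {M} → M ∈GL₂[ℤ] → Matrix.P M ≡ 0ℤ → Matrix.Q M ≢ 0ℤ
column≢0 {matrix _ _ _ _} (matrix a b _ _ , NM≡I , _) ≡.refl ≡.refl
  with ≡.trans (≡.sym (≡.cong₂ _+ᶻ_ (ℤ.*-zeroʳ a) (ℤ.*-zeroʳ b))) (≡.cong Matrix.P NM≡I)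
... | ()

Q≢0 : ∀ {M} → M ∈GL₂[ℤ] → 0ℤ ≤ᶻ Matrix.P M → Matrix.P M ≤ᶻ Matrix.Q M → Matrix.Q M ≢ 0ℤ
Q≢0 M∈GL₂ 0≤P P≤Q Q≡0 = column≢0 M∈GL₂ (ℤ.≤-antisym (≡.subst (_ ≤ᶻ_) Q≡0 P≤Q) 0≤P) Q≡0

-- Constructive ordered fields: strict order primitive, x ≤ y meaning
-- ¬ y < x, and cotransitivity in place of trichotomy.  Classically these
-- are the usual ordered fields.

record OrderedField c ℓ₁ ℓ₂ : Set (suc (c ⊔ˡ ℓ₁ ⊔ˡ ℓ₂)) where
  infix  8 -_
  infixl 7 _*_
  infixl 6 _+_ _⊔_
  infix  4 _≈_ _<_ _≤_ _#_
  field
    Carrier : Set c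
    _≈_     : Rel Carrier ℓ₁
    _<_     : Rel Carrier ℓ₂
    _+_     : Op₂ Carrier
    _*_     : Op₂ Carrier
    -_      : Op₁ Carrier
    _⊔_     : Op₂ Carrier
    0#      : Carrier
    1#      : Carrier

  _≤_ : Rel Carrier ℓ₂
  x ≤ y = ¬ (y < x)

  _#_ : Rel Carrier ℓ₂
  x # y = x < y ⊎ y < x

  field
    isHeytingField       : IsHeytingField _≈_ _#_ _+_ _*_ -_ 0# 1#
    isStrictPartialOrder : IsStrictPartialOrder _≈_ _<_
    <-cotrans            : Cotransitive _<_
    ⊔-supremum           : Supremum _≤_ _⊔_
    0<1                  : 0# < 1#
    +-monoˡ-<            : ∀ z {x y} → x < y → x + z < y + z
    *-pos                : ∀ {x y} → 0# < x → 0# < y → 0# < x * y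

  heytingField : HeytingField c ℓ₁ ℓ₂
  heytingField = record { isHeytingField = isHeytingField }

  open IsHeytingField isHeytingField public
    using (tight; #-sym; #-irrefl; #⇒invertible; invertible⇒#)

  commutativeRing : CommutativeRing c ℓ₁
  commutativeRing = record { isCommutativeRing = IsHeytingField.isCommutativeRing isHeytingField }

  open CommutativeRing commutativeRing public
    hiding (Carrier; _≈_; _+_; _*_; -_; 0#; 1#)

  open IsStrictPartialOrder isStrictPartialOrder public
    using () renaming (irrefl to <-irrefl; trans to <-trans; <-respʳ-≈ to <-respʳ; <-respˡ-≈ to <-respˡ)

  ∣_∣ : Carrier → Carrier
  ∣ x ∣ = x ⊔ (- x)

module FieldTheory {c ℓ₁ ℓ₂} (F : OrderedField c ℓ₁ ℓ₂) where
  open OrderedField F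
  open HeytingProperties (HeytingField.heytingCommutativeRing heytingField)
    using (x-0≈x; x#0y#0→xy#0; #-congʳ; #-congˡ; 1#0) public
  open RingProperties ring using (-0#≈0#; -‿involutive; -‿distribˡ-*; -‿+-comm) public
  open Mult semiring using (×1-homo-*; 1+×; ×-homo-+)
  open RawMonoidDefinitions +-rawMonoid using (_×′_)

  ι : ℤ → Carrier
  ι (+ n)    = n ×′ 1#
  ι -[1+ n ] = - (ℕ.suc n ×′ 1#)

  private
    open module ≈-Reasoning = SetoidReasoning setoid

  abstract
    ι-neg : ∀ m → ι (-ᶻ m) ≈ - ι m
    ι-neg (+ zero)     = sym -0#≈0#
    ι-neg (+ ℕ.suc n)  = refl
    ι-neg -[1+ n ]     = sym (-‿involutive _)

    ι-⊖ : ∀ m n → ι (m ⊖ n) ≈ ι (+ m) - ι (+ n)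
    ι-⊖ m zero = begin
      ι (m ⊖ 0)      ≈⟨ sym (+-identityʳ _) ⟩
      ι (+ m) + 0#   ≈⟨ +-congˡ (sym -0#≈0#) ⟩
      ι (+ m) - 0#   ∎
    ι-⊖ zero (ℕ.suc n) = sym (+-identityˡ _)
    ι-⊖ (ℕ.suc m) (ℕ.suc n) = begin
      ι (ℕ.suc m ⊖ ℕ.suc n)                    ≡⟨ ≡.cong ι (ℤ.[1+m]⊖[1+n]≡m⊖n m n) ⟩
      ι (m ⊖ n)                                ≈⟨ ι-⊖ m n ⟩
      x - y                                    ≈⟨ +-congʳ (sym (+-identityʳ x)) ⟩
      x + 0# - y                               ≈⟨ +-congʳ (+-congˡ (sym (-‿inverseʳ 1#))) ⟩
      x + (1# - 1#) - y                        ≈⟨ +-congʳ (sym (+-assoc x 1# (- 1#))) ⟩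
      x + 1# - 1# - y                          ≈⟨ +-assoc _ _ _ ⟩
      x + 1# + (- 1# - y)                      ≈⟨ +-cong (+-comm x 1#) (-‿+-comm 1# y) ⟩
      1# + x - (1# + y)                        ≈⟨ sym (+-cong (1+× m 1#) (-‿cong (1+× n 1#))) ⟩
      ι (+ ℕ.suc m) - ι (+ ℕ.suc n)            ∎
      where
      x y : Carrier
      x = ι (+ m)
      y = ι (+ n)

    ι-+ : ∀ m n → ι (m +ᶻ n) ≈ ι m + ι n
    ι-+ (+ m)    (+ n)    = ×-homo-+ 1# m n
    ι-+ (+ m)    -[1+ n ] = ι-⊖ m (ℕ.suc n)
    ι-+ -[1+ m ] (+ n)    = trans (ι-⊖ n (ℕ.suc m)) (+-comm _ _)
    ι-+ -[1+ m ] -[1+ n ] = begin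
      - (ℕ.suc (ℕ.suc (m ℕ.+ n)) ×′ 1#)          ≡⟨ ≡.cong (λ k → - (ℕ.suc k ×′ 1#)) (≡.sym (ℕ.+-suc m n)) ⟩
      - ((ℕ.suc m ℕ.+ ℕ.suc n) ×′ 1#)            ≈⟨ -‿cong (×-homo-+ 1# (ℕ.suc m) (ℕ.suc n)) ⟩
      - (ℕ.suc m ×′ 1# + ℕ.suc n ×′ 1#)          ≈⟨ sym (-‿+-comm _ _) ⟩
      - (ℕ.suc m ×′ 1#) - (ℕ.suc n ×′ 1#)        ∎

    ι-+n* : ∀ m n → ι (+ m *ᶻ n) ≈ ι (+ m) * ι n
    ι-+n* m (+ n) = begin
      ι (+ m *ᶻ + n)       ≡⟨ ≡.cong ι (≡.sym (ℤ.pos-* m n)) ⟩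
      ι (+ (m ℕ.* n))      ≈⟨ ×1-homo-* m n ⟩
      ι (+ m) * ι (+ n)    ∎
    ι-+n* m -[1+ n ] = begin
      ι (+ m *ᶻ -[1+ n ])            ≡⟨ ≡.cong ι (≡.sym (ℤ.neg-distribʳ-* (+ m) (+ ℕ.suc n))) ⟩
      ι (-ᶻ (+ m *ᶻ + ℕ.suc n))      ≈⟨ ι-neg (+ m *ᶻ + ℕ.suc n) ⟩
      - ι (+ m *ᶻ + ℕ.suc n)         ≈⟨ -‿cong (ι-+n* m (+ ℕ.suc n)) ⟩
      - (ι (+ m) * ι (+ ℕ.suc n))    ≈⟨ RingProperties.-‿distribʳ-* ring _ _ ⟩
      ι (+ m) * - ι (+ ℕ.suc n)      ∎

    ι-* : ∀ m n → ι (m *ᶻ n) ≈ ι m * ι n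
    ι-* (+ m)    n = ι-+n* m n
    ι-* -[1+ m ] n = begin
      ι (-[1+ m ] *ᶻ n)              ≡⟨ ≡.cong ι (≡.sym (ℤ.neg-distribˡ-* (+ ℕ.suc m) n)) ⟩
      ι (-ᶻ (+ ℕ.suc m *ᶻ n))        ≈⟨ ι-neg (+ ℕ.suc m *ᶻ n) ⟩
      - ι (+ ℕ.suc m *ᶻ n)           ≈⟨ -‿cong (ι-+n* (ℕ.suc m) n) ⟩
      - (ι (+ ℕ.suc m) * ι n)        ≈⟨ -‿distribˡ-* _ _ ⟩
      - ι (+ ℕ.suc m) * ι n          ∎

  private
    acr : AlmostCommutativeRing c ℓ₁
    acr = fromCommutativeRing commutativeRing

    ι-morphism : CommutativeRing.rawRing ℤ.+-*-commutativeRing -Raw-AlmostCommutative⟶ acr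
    ι-morphism = record
      { ⟦_⟧    = ι
      ; +-homo = ι-+
      ; *-homo = ι-*
      ; -‿homo = ι-neg
      ; 0-homo = refl
      ; 1-homo = refl
      }

    ι-≟ : ∀ m n → Maybe (ι m ≈ ι n)
    ι-≟ m n with m ℤ.≟ n
    ... | yes ≡.refl = just refl
    ... | no  _      = nothing

  open RingSolver (CommutativeRing.rawRing ℤ.+-*-commutativeRing) acr ι-morphism ι-≟ public
    using (solve; con; _:=_; _:+_; _:*_; _:-_; :-_)

  abstract
    <⇒0<- : ∀ {x y} → x < y → 0# < y - x
    <⇒0<- {x} x<y = <-respˡ (-‿inverseʳ x) (+-monoˡ-< (- x) x<y)

    0<-⇒< : ∀ {x y} → 0# < y - x → x < y
    0<-⇒< {x} {y} 0<y-x = <-respʳ (solve 2 (λ x y → (y :- x) :+ x := y) refl x y)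
      (<-respˡ (+-identityˡ x) (+-monoˡ-< x 0<y-x))

    *-monoˡ-<-pos : ∀ {z x y} → 0# < z → x < y → x * z < y * z
    *-monoˡ-<-pos {z} {x} {y} 0<z x<y = 0<-⇒<
      (<-respʳ (solve 3 (λ x y z → (y :- x) :* z := y :* z :- x :* z) refl x y z)
        (*-pos (<⇒0<- x<y) 0<z))

    square-mono-< : ∀ {x y} → 0# < x → x < y → x * x < y * y
    square-mono-< 0<x x<y = <-trans (*-monoˡ-<-pos 0<x x<y)
      (<-respˡ (*-comm _ _) (*-monoˡ-<-pos (<-trans 0<x x<y) x<y))

    +-pos : ∀ {x y} → 0# < x → 0# < y → 0# < x + y
    +-pos {x} {y} 0<x 0<y = <-trans 0<y (<-respˡ (+-identityˡ y) (+-monoˡ-< y 0<x))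

    <-asym : ∀ {x y} → x < y → ¬ (y < x)
    <-asym x<y y<x = <-irrefl refl (<-trans x<y y<x)

    ≤-<-trans : ∀ {x y z} → x ≤ y → y < z → x < z
    ≤-<-trans {x} x≤y y<z = [ ⊥-elim ∘ x≤y , (λ x<z → x<z) ]′ (<-cotrans y<z x)

    <-≤-trans : ∀ {x y z} → x < y → y ≤ z → x < z
    <-≤-trans {z = z} x<y y≤z = [ (λ x<z → x<z) , ⊥-elim ∘ y≤z ]′ (<-cotrans x<y z)

    neg-mono-< : ∀ {x y} → x < y → - y < - x
    neg-mono-< {x} {y} x<y = 0<-⇒<
      (<-respʳ (solve 2 (λ x y → y :- x := (:- x) :- (:- y)) refl x y) (<⇒0<- x<y))

    ι-pos : ∀ n → 0# < ι (+ ℕ.suc n)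
    ι-pos zero      = 0<1
    ι-pos (ℕ.suc n) = +-pos (ι-pos n) 0<1

    ι-mono-<ᴺ : ∀ {m n} → m ℕ.< n → ι (+ m) < ι (+ n)
    ι-mono-<ᴺ {m} {n} m<n with ℕ.m<n⇒0<n∸m m<n | ℕ.m+[n∸m]≡n (ℕ.<⇒≤ m<n)
    ... | 0<d | m+d≡n with n ℕ.∸ m
    ...   | ℕ.suc d = ≡.subst (λ k → ι (+ m) < ι (+ k)) m+d≡n
      (<-respʳ (trans (+-comm _ _) (sym (ι-+ (+ m) (+ ℕ.suc d))))
        (<-respˡ (+-identityˡ _) (+-monoˡ-< (ι (+ m)) (ι-pos d))))

    ι#0 : ∀ {m} → m ≢ 0ℤ → ι m # 0#
    ι#0 {+ zero}      m≢0 = ⊥-elim (m≢0 ≡.refl)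
    ι#0 {+ ℕ.suc n}   _   = inj₂ (ι-pos n)
    ι#0 { -[1+ n ]}   _   = inj₁ (<-respʳ -0#≈0# (neg-mono-< (ι-pos n)))

  infix 9 _⁻¹[_]
  infix 7 _÷_[_]

  _⁻¹[_] : ∀ x → x # 0# → Carrier
  x ⁻¹[ x#0 ] = proj₁ (#⇒invertible x#0)

  _÷_[_] : ∀ x y → y # 0# → Carrier
  x ÷ y [ y#0 ] = x * y ⁻¹[ y#0 ]

  abstract
    ⁻¹-inverseʳ : ∀ x (x#0 : x # 0#) → x * x ⁻¹[ x#0 ] ≈ 1#
    ⁻¹-inverseʳ x x#0 = trans (*-congʳ (sym (x-0≈x x))) (proj₂ (proj₂ (#⇒invertible x#0)))

    inverse⇒#0 : ∀ {x y} → x * y ≈ 1# → x # 0#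
    inverse⇒#0 {x} {y} xy≈1 = invertible⇒#
      (y , trans (*-congˡ (x-0≈x x)) (trans (*-comm y x) xy≈1) , trans (*-congʳ (x-0≈x x)) xy≈1)

    xy#0⇒x#0 : ∀ {x y} → x * y # 0# → x # 0#
    xy#0⇒x#0 {x} {y} xy#0 = inverse⇒#0 (trans (sym (*-assoc x y _)) (⁻¹-inverseʳ (x * y) xy#0))

    inverse-pos : ∀ {x y} → x * y ≈ 1# → 0# < x → 0# < y
    inverse-pos {x} {y} xy≈1 0<x with inverse⇒#0 (trans (*-comm y x) xy≈1)
    ... | inj₂ 0<y = 0<y
    ... | inj₁ y<0 = ⊥-elim (<-asym 0<1
      (<-respˡ (trans (*-comm y x) xy≈1) (<-respʳ (zeroˡ x) (*-monoˡ-<-pos 0<x y<0))))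

    inverse-anti-mono-< : ∀ {x x′ y y′} → x * x′ ≈ 1# → y * y′ ≈ 1# →
                          0# < x′ → 0# < y′ → x < y → y′ < x′
    inverse-anti-mono-< {x} {x′} {y} {y′} xx′≈1 yy′≈1 0<x′ 0<y′ x<y =
      <-respˡ (trans (sym (*-assoc _ _ _)) (trans (*-congʳ xx′≈1) (*-identityˡ y′)))
        (<-respʳ (trans (*-congˡ (*-comm _ _)) (trans (sym (*-assoc _ _ _)) (trans (*-congʳ yy′≈1) (*-identityˡ x′))))
          (*-monoˡ-<-pos (*-pos 0<x′ 0<y′) x<y))

    #⇒-#0 : ∀ {x y} → x # y → x - y # 0#
    #⇒-#0 {x} {y} (inj₁ x<y) = inj₁ (<-respʳ (-‿inverseʳ y) (+-monoˡ-< (- y) x<y))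
    #⇒-#0 {x} {y} (inj₂ y<x) = inj₂ (<⇒0<- y<x)

    -#0⇒# : ∀ {x y} → x - y # 0# → x # y
    -#0⇒# {x} {y} (inj₁ d<0) = inj₁ (0<-⇒< (<-respʳ (solve 2 (λ x y → con 0ℤ :- (x :- y) := y :- x) refl x y) (<⇒0<- d<0)))
    -#0⇒# {x} {y} (inj₂ 0<d) = inj₂ (0<-⇒< 0<d)

  -- Positive form of irrationality: apartness from every p/q, which is
  -- what makes integer parts computable.  Classically, x ∉ ℚ.
  Irrational : Carrier → Set ℓ₂
  Irrational x = ∀ p q (q≢0 : q ≢ 0ℤ) → x # ι p ÷ ι q [ ι#0 q≢0 ]

  abstract
    irrational⇒linear#0 : ∀ {x} → Irrational x → ∀ α β → ¬ (α ≡ 0ℤ × β ≡ 0ℤ) → ι α * x + ι β # 0#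
    irrational⇒linear#0 {x} irr α β αβ≢0 with α ℤ.≟ 0ℤ
    ... | yes ≡.refl = #-congʳ (solve 2 (λ x b → b := con 0ℤ :* x :+ b) refl x (ι β)) (ι#0 (λ β≡0 → αβ≢0 (≡.refl , β≡0)))
    ... | no  α≢0    = #-congʳ lemma (x#0y#0→xy#0 (ι#0 α≢0) (#⇒-#0 (irr (-ᶻ β) α α≢0)))
      where
      i : Carrier
      i = ι α ⁻¹[ ι#0 α≢0 ]
      lemma : ι α * (x - ι (-ᶻ β) * i) ≈ ι α * x + ι β
      lemma = trans
        (*-congˡ (+-congˡ (-‿cong (*-congʳ (ι-neg β)))))
        (trans (solve 4 (λ a x b i → a :* (x :- (:- b) :* i) := a :* x :+ b :* (a :* i)) refl (ι α) x (ι β) i)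
          (+-congˡ (trans (*-congˡ (⁻¹-inverseʳ (ι α) (ι#0 α≢0))) (*-identityʳ _))))

    linear#0⇒irrational : ∀ {x} → (∀ p q → q ≢ 0ℤ → ι q * x + ι p # 0#) → Irrational x
    linear#0⇒irrational {x} lin p q q≢0 = -#0⇒# (xy#0⇒x#0 (#-congʳ lemma (lin (-ᶻ p) q q≢0)))
      where
      i : Carrier
      i = ι q ⁻¹[ ι#0 q≢0 ]
      lemma : ι q * x + ι (-ᶻ p) ≈ (x - ι p * i) * ι q
      lemma = trans (+-congˡ (trans (ι-neg p) (-‿cong (trans (sym (*-identityʳ _)) (*-congˡ (sym (⁻¹-inverseʳ (ι q) (ι#0 q≢0))))))))
        (solve 4 (λ q x p i → q :* x :- p :* (q :* i) := (x :- p :* i) :* q) refl (ι q) x (ι p) i)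

    irrational-inverse : ∀ {x y} → x * y ≈ 1# → Irrational x → Irrational y
    irrational-inverse {x} {y} xy≈1 irr = linear#0⇒irrational λ p q q≢0 →
      xy#0⇒x#0 {y = x} (#-congʳ
        (trans (+-congˡ (trans (sym (*-identityʳ _)) (*-congˡ (sym xy≈1))))
          (solve 4 (λ p q x y → p :* x :+ q :* (x :* y) := (q :* y :+ p) :* x) refl (ι p) (ι q) x y))
        (irrational⇒linear#0 irr p q (q≢0 ∘ proj₂)))

    irrational-affine : ∀ {y} → Irrational y → ∀ m k → m ≢ 0ℤ → Irrational (ι m * y + ι k)
    irrational-affine {y} irr m k m≢0 = linear#0⇒irrational λ p q q≢0 →
      #-congʳ (trans (+-cong (*-congʳ (ι-* q m)) (trans (ι-+ (q *ᶻ k) p) (+-congʳ (ι-* q k))))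
          (solve 5 (λ q m k p y → q :* m :* y :+ (q :* k :+ p) := q :* (m :* y :+ k) :+ p) refl (ι q) (ι m) (ι k) (ι p) y))
        (irrational⇒linear#0 irr (q *ᶻ m) (q *ᶻ k +ᶻ p)
          (λ (qm≡0 , _) → [ q≢0 , m≢0 ]′ (ℤ.i*j≡0⇒i≡0∨j≡0 q qm≡0)))

    irrational-cong : ∀ {x y} → x ≈ y → Irrational x → Irrational y
    irrational-cong x≈y irr p q q≢0 = #-congʳ x≈y (irr p q q≢0)

    irrational#ι : ∀ {x} → Irrational x → ∀ k → x # ι k
    irrational#ι irr k = #-congˡ lemma (irr k 1ℤ (λ ()))
      where
      lemma : ι k ÷ ι 1ℤ [ ι#0 {1ℤ} (λ ()) ] ≈ ι k
      lemma = trans (*-congˡ (trans (sym (*-identityˡ _)) (⁻¹-inverseʳ 1# _))) (*-identityʳ _)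

-- Models of ℝ: Archimedean, order-complete ordered fields, of which
-- there is exactly one up to isomorphism.  The last hypothesis of `sup`
-- (S is order-located) holds for every S in classical logic, where `sup`
-- is then the usual least-upper-bound axiom.

record Reals c ℓ₁ ℓ₂ : Set (suc (c ⊔ˡ ℓ₁ ⊔ˡ ℓ₂)) where
  field
    orderedField : OrderedField c ℓ₁ ℓ₂
  open OrderedField orderedField public
  open FieldTheory orderedField public

  UpperBound : Pred Carrier ℓ₂ → Carrier → Set (c ⊔ˡ ℓ₂)
  UpperBound S b = ∀ y → S y → y ≤ b

  field
    archimedean : ∀ x → ∃[ n ] x < ι (+ n)
    sup : (S : Pred Carrier ℓ₂) → ∃ S → ∃ (UpperBound S) →
          (∀ a b → a < b → (∃[ y ] S y × a < y) ⊎ UpperBound S b) →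
          ∃[ s ] UpperBound S s × (∀ a → a < s → ∃[ y ] S y × a < y)

module OCF {c ℓ₁ ℓ₂} (R : Reals c ℓ₁ ℓ₂) where
  open Reals R

  2# 5# : Carrier
  2# = ι (+ 2)
  5# = ι (+ 5)

  abstract
    2#0 : 2# # 0#
    2#0 = ι#0 {+ 2} (λ ())

  module SquareRootOfFive where
    S : Pred Carrier ℓ₂
    S y = y * y < 5#

    3# 4# : Carrier
    3# = ι (+ 3)
    4# = ι (+ 4)

    -- z = (3s+5)/(s+3) satisfies z − s = (5 − s²)/(s+3) and
    -- 5 − z² = 4(5 − s²)/(s+3)², so it lies strictly between s and √5.
    module Step (s w : Carrier) (0<s : 0# < s) ([s+3]w≈1 : (s + 3#) * w ≈ 1#) where

      z : Carrier
      z = (3# * s + 5#) * w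

      abstract
        0<w : 0# < w
        0<w = inverse-pos [s+3]w≈1 (+-pos 0<s (ι-pos 2))

        0<z : 0# < z
        0<z = *-pos (+-pos (*-pos (ι-pos 2) 0<s) (ι-pos 4)) 0<w

        0<4w² : 0# < 4# * (w * w)
        0<4w² = *-pos (ι-pos 3) (*-pos 0<w 0<w)

        difference : ∀ s w → (3# * s + 5#) * w - s * ((s + 3#) * w) ≈ (5# - s * s) * w
        difference = solve 2 (λ s w → (con (+ 3) :* s :+ con (+ 5)) :* w :- s :* ((s :+ con (+ 3)) :* w)
                                      := (con (+ 5) :- s :* s) :* w) refl

        z-s : z - s ≈ (5# - s * s) * w
        z-s = trans (+-congˡ (-‿cong (sym (trans (*-congˡ [s+3]w≈1) (*-identityʳ s))))) (difference s w)

        factor : ∀ s → 5# * ((s + 3#) * (s + 3#)) - (3# * s + 5#) * (3# * s + 5#) ≈ (5# - s * s) * 4#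
        factor = solve 1 (λ s → con (+ 5) :* ((s :+ con (+ 3)) :* (s :+ con (+ 3)))
                                  :- (con (+ 3) :* s :+ con (+ 5)) :* (con (+ 3) :* s :+ con (+ 5))
                                := (con (+ 5) :- s :* s) :* con (+ 4)) refl

        common : ∀ e a b w → e * ((a * w) * (a * w)) - (b * w) * (b * w) ≈ (e * (a * a) - b * b) * (w * w)
        common = solve 4 (λ e a b w → e :* ((a :* w) :* (a :* w)) :- (b :* w) :* (b :* w)
                                      := (e :* (a :* a) :- b :* b) :* (w :* w)) refl

        5-z² : 5# - z * z ≈ (5# - s * s) * (4# * (w * w))
        5-z² = trans (+-congʳ (sym (trans (*-congˡ (trans (*-cong [s+3]w≈1 [s+3]w≈1) (*-identityʳ 1#))) (*-identityʳ 5#))))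
          (trans (common 5# (s + 3#) (3# * s + 5#) w)
            (trans (*-congʳ (factor s)) (*-assoc (5# - s * s) 4# (w * w))))

        negate : ∀ {a b c d e} → a - b ≈ (c - d) * e → b - a ≈ (d - c) * e
        negate {a} {b} {c} {d} {e} p = trans (solve 2 (λ a b → b :- a := :- (a :- b)) refl a b)
          (trans (-‿cong p) (solve 3 (λ c d e → :- ((c :- d) :* e) := (d :- c) :* e) refl c d e))

        increase : s * s < 5# → s < z × z * z < 5#
        increase s²<5 = 0<-⇒< (<-respʳ (sym z-s) (*-pos (<⇒0<- s²<5) 0<w))
                      , 0<-⇒< (<-respʳ (sym 5-z²) (*-pos (<⇒0<- s²<5) 0<4w²))

        decrease : 5# < s * s → z < s × 5# < z * z
        decrease 5<s² = 0<-⇒< (<-respʳ (sym (negate z-s)) (*-pos (<⇒0<- 5<s²) 0<w))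
                      , 0<-⇒< (<-respʳ (sym (negate 5-z²)) (*-pos (<⇒0<- 5<s²) 0<4w²))

    abstract
      S-0 : S 0#
      S-0 = <-respˡ (sym (zeroˡ 0#)) (ι-pos 4)

      S-1 : S 1#
      S-1 = <-respˡ (sym (*-identityˡ 1#)) (ι-mono-<ᴺ {1} {5} (ℕ.s≤s (ℕ.s≤s ℕ.z≤n)))

      bound : ∀ {b} → 0# < b → 5# < b * b → UpperBound S b
      bound 0<b 5<b² y y²<5 b<y = <-asym (<-trans 5<b² (square-mono-< 0<b b<y)) y²<5

      5<25 : 5# < 5# * 5#
      5<25 = <-respʳ (ι-* (+ 5) (+ 5)) (ι-mono-<ᴺ {5} {25} (ℕ.m<m+n 5 {20} (ℕ.s≤s ℕ.z≤n)))

      inverse : ∀ {x} → 0# < x → ∃[ y ] x * y ≈ 1#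
      inverse {x} 0<x = x ⁻¹[ inj₂ 0<x ] , ⁻¹-inverseʳ x (inj₂ 0<x)

      lower : ∀ a b h → (b - a) * h ≈ (a + b) * h - a * (2# * h)
      lower = solve 3 (λ a b h → (b :- a) :* h := (a :+ b) :* h :- a :* (con (+ 2) :* h)) refl

      upper : ∀ a b h → (b - a) * h ≈ b * (2# * h) - (a + b) * h
      upper = solve 3 (λ a b h → (b :- a) :* h := b :* (con (+ 2) :* h) :- (a :+ b) :* h) refl

      midpoint : ∀ {a b} h → 2# * h ≈ 1# → a < b → ∃[ m ] a < m × m < b
      midpoint {a} {b} h 2h≈1 a<b =
        (a + b) * h ,
        0<-⇒< (<-respʳ (trans (lower a b h) (+-congˡ (-‿cong (unit a)))) 0<[b-a]h) ,
        0<-⇒< (<-respʳ (trans (upper a b h) (+-congʳ (unit b))) 0<[b-a]h)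
        where
        unit : ∀ x → x * (2# * h) ≈ x
        unit x = trans (*-congˡ 2h≈1) (*-identityʳ x)
        0<[b-a]h : 0# < (b - a) * h
        0<[b-a]h = *-pos (<⇒0<- a<b) (inverse-pos {2#} {h} 2h≈1 (ι-pos 1))

      dense : ∀ {a b} → a < b → ∃[ m ] a < m × m < b
      dense = midpoint (proj₁ (inverse (ι-pos 1))) (proj₂ (inverse (ι-pos 1)))

      located : ∀ a b → a < b → (∃[ y ] S y × a < y) ⊎ UpperBound S b
      located a b a<b = split (dense a<b)
        where
        split : ∃[ m ] a < m × m < b → (∃[ y ] S y × a < y) ⊎ UpperBound S b
        split (m , a<m , m<b) =
          [ (λ a<0 → inj₁ (0# , S-0 , a<0))
          , (λ 0<m → [ (λ m²<5 → inj₁ (m , m²<5 , a<m))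
                     , (λ 5<b² → inj₂ (bound (<-trans 0<m m<b) 5<b²))
                     ]′ (<-cotrans (square-mono-< 0<m m<b) 5#))
          ]′ (<-cotrans a<m 0#)

      isRoot : ∀ s → UpperBound S s → (∀ a → a < s → ∃[ y ] S y × a < y) → 0# < s × s * s ≈ 5#
      isRoot s upperBound approximable = 0<s , proj₁ (tight _ _) [ s²≮5 , 5≮s² ]′
        where
        0<s : 0# < s
        0<s = <-≤-trans 0<1 (upperBound 1# S-1)
        0<s+3 : 0# < s + 3#
        0<s+3 = +-pos 0<s (ι-pos 2)
        open Step s (proj₁ (inverse 0<s+3)) 0<s (proj₂ (inverse 0<s+3)) using (z; 0<z; increase; decrease)
        s²≮5 : ¬ (s * s < 5#)
        s²≮5 s²<5 = upperBound z (proj₂ (increase s²<5)) (proj₁ (increase s²<5))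
        5≮s² : ¬ (5# < s * s)
        5≮s² 5<s² with approximable z (proj₁ (decrease 5<s²))
        ... | y , y²<5 , z<y = bound 0<z (proj₂ (decrease 5<s²)) y y²<5 z<y

      root : ∃[ s ] 0# < s × s * s ≈ 5#
      root = s , isRoot s upperBound approximable
        where
        supremum : ∃[ s ] UpperBound S s × (∀ a → a < s → ∃[ y ] S y × a < y)
        supremum = sup S (0# , S-0) (5# , bound (ι-pos 4) 5<25) located
        s : Carrier
        s = proj₁ supremum
        upperBound : UpperBound S s
        upperBound = proj₁ (proj₂ supremum)
        approximable : ∀ a → a < s → ∃[ y ] S y × a < y
        approximable = proj₂ (proj₂ supremum)

  √5 : Carrier
  √5 = proj₁ SquareRootOfFive.root

  0<√5 : 0# < √5
  0<√5 = proj₁ (proj₂ SquareRootOfFive.root)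

  √5*√5≈5 : √5 * √5 ≈ 5#
  √5*√5≈5 = proj₂ (proj₂ SquareRootOfFive.root)

  g : Carrier
  g = (√5 - 1#) ÷ 2# [ 2#0 ]

  IntegerPart : Carrier → ℤ → Set ℓ₂
  IntegerPart y k = ι k ≤ y × y < ι (k +ᶻ 1ℤ)

  integerPart : ∀ {y} → Irrational y → 0# < y → ∃[ k ] IntegerPart y (+ k)
  integerPart {y} irr 0<y = search (proj₁ (archimedean y)) (proj₂ (archimedean y))
    where
    search : ∀ n → y < ι (+ n) → ∃[ k ] IntegerPart y (+ k)
    search zero      y<0 = ⊥-elim (<-asym 0<y y<0)
    search (ℕ.suc n) y<1+n with irrational#ι irr (+ n)
    ... | inj₁ y<n = search n y<n
    ... | inj₂ n<y = n , <-asym n<y , ≡.subst (λ k → y < ι (+ k)) (ℕ.+-comm 1 n) y<1+n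

  record Ω : Set (c ⊔ˡ ℓ₂) where
    constructor mkΩ
    field
      value      : Carrier
      0≤value    : 0# ≤ value
      value≤1    : value ≤ 1#
      irrational : Irrational value
  open Ω public

  module _ (x : Ω) where

    0<value : 0# < value x
    0<value = [ ⊥-elim ∘ 0≤value x , (λ p → p) ]′ (irrational#ι (irrational x) 0ℤ)

    1/_ : Carrier
    1/_ = 1# ÷ value x [ inj₂ 0<value ]

    abstract
      x*1/x≈1 : value x * 1/_ ≈ 1#
      x*1/x≈1 = trans (*-congˡ (*-identityˡ _)) (⁻¹-inverseʳ (value x) _)

      1/-irrational : Irrational 1/_
      1/-irrational = irrational-inverse x*1/x≈1 (irrational x)

      0<1/ : 0# < 1/_
      0<1/ = inverse-pos x*1/x≈1 0<value

    ⌊1/_⌋ : ℕ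
    ⌊1/_⌋ = proj₁ (integerPart 1/-irrational 0<1/)

    ⌊1/⌋-integerPart : IntegerPart 1/_ (+ ⌊1/_⌋)
    ⌊1/⌋-integerPart = proj₂ (integerPart 1/-irrational 0<1/)

    frac1/_ : Carrier
    frac1/_ = 1/_ - ι (+ ⌊1/_⌋)

  1/ℕ : ∀ n → NonZero n → Carrier
  1/ℕ (ℕ.suc n) _ = 1# ÷ ι (+ ℕ.suc n) [ inj₂ (ι-pos n) ]

  D : Pred Carrier ℓ₂
  D x = ∃[ n ] Σ[ n≢0 ∈ NonZero n ] 2 ∣ n × 1/ℕ (ℕ.suc n) _ ≤ x × x < 1/ℕ n n≢0

  -- Membership in D is decidable on Ω: x ∈ D exactly when ⌊1/x⌋ is even.
  module _ (x : Ω) where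
    private
      k : ℕ
      k = ⌊1/ x ⌋

    abstract
      1/ℕ-inverse : ∀ n (n≢0 : NonZero n) → ι (+ n) * 1/ℕ n n≢0 ≈ 1#
      1/ℕ-inverse (ℕ.suc n) _ = trans (*-congˡ (*-identityˡ _)) (⁻¹-inverseʳ (ι (+ ℕ.suc n)) _)

      1/ℕ-pos : ∀ n (n≢0 : NonZero n) → 0# < 1/ℕ n n≢0
      1/ℕ-pos (ℕ.suc n) n≢0 = inverse-pos (1/ℕ-inverse (ℕ.suc n) n≢0) (ι-pos n)

      x<1/n⇒n<1/x : ∀ n n≢0 → value x < 1/ℕ n n≢0 → ι (+ n) < 1/ x
      x<1/n⇒n<1/x (ℕ.suc n) n≢0 = inverse-anti-mono-< (x*1/x≈1 x)
        (trans (*-comm _ _) (1/ℕ-inverse (ℕ.suc n) n≢0)) (0<1/ x) (ι-pos n)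

      n<1/x⇒x<1/n : ∀ n n≢0 → ι (+ n) < 1/ x → value x < 1/ℕ n n≢0
      n<1/x⇒x<1/n n n≢0 = inverse-anti-mono-< (1/ℕ-inverse n n≢0)
        (trans (*-comm _ _) (x*1/x≈1 x)) (1/ℕ-pos n n≢0) (0<value x)

      1/n<x⇒1/x<n : ∀ n n≢0 → 1/ℕ n n≢0 < value x → 1/ x < ι (+ n)
      1/n<x⇒1/x<n (ℕ.suc n) n≢0 = inverse-anti-mono-< (trans (*-comm _ _) (1/ℕ-inverse (ℕ.suc n) n≢0))
        (x*1/x≈1 x) (ι-pos n) (0<1/ x)

      1/x<n⇒1/n<x : ∀ n n≢0 → 1/ x < ι (+ n) → 1/ℕ n n≢0 < value x
      1/x<n⇒1/n<x n n≢0 = inverse-anti-mono-< (trans (*-comm _ _) (x*1/x≈1 x))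
        (1/ℕ-inverse n n≢0) (0<value x) (1/ℕ-pos n n≢0)

      ι-cancel-< : ∀ {m n} → ι (+ m) < ι (+ n) → m ℕ.< n
      ι-cancel-< {m} {n} ιm<ιn with m ℕ.<? n
      ... | yes m<n = m<n
      ... | no  m≮n with ℕ.m≤n⇒m<n∨m≡n (ℕ.≮⇒≥ m≮n)
      ...   | inj₁ n<m    = ⊥-elim (<-asym ιm<ιn (ι-mono-<ᴺ n<m))
      ...   | inj₂ ≡.refl = ⊥-elim (<-irrefl refl ιm<ιn)

      k<1/x : ι (+ k) < 1/ x
      k<1/x = [ ⊥-elim ∘ proj₁ (⌊1/⌋-integerPart x) , (λ p → p) ]′ (irrational#ι (1/-irrational x) (+ k))

      1/x<1+k : 1/ x < ι (+ ℕ.suc k)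
      1/x<1+k = ≡.subst (λ n → 1/ x < ι (+ n)) (ℕ.+-comm k 1) (proj₂ (⌊1/⌋-integerPart x))

      k≢0 : NonZero k
      k≢0 = ℕ.≢-nonZero λ k≡0 → value≤1 x
        (<-respˡ (trans (sym (*-identityˡ _)) (1/ℕ-inverse 1 _))
          (1/x<n⇒1/n<x 1 _ (≡.subst (λ n → 1/ x < ι (+ ℕ.suc n)) k≡0 1/x<1+k)))

      even⇒D : 2 ∣ k → D (value x)
      even⇒D 2∣k = k , k≢0 , 2∣k , <-asym (1/x<n⇒1/n<x (ℕ.suc k) _ 1/x<1+k) , n<1/x⇒x<1/n k k≢0 k<1/x

      D⇒even : D (value x) → 2 ∣ k
      D⇒even (n , n≢0 , 2∣n , 1/[1+n]≤x , x<1/n) = ≡.subst (2 ∣_) (ℕ.≤-antisym n≤k k≤n) 2∣n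
        where
        n≤k : n ℕ.≤ k
        n≤k = ℕ.s≤s⁻¹ (ι-cancel-< (<-trans (x<1/n⇒n<1/x n n≢0 x<1/n) 1/x<1+k))
        1/x<1+n : 1/ x < ι (+ ℕ.suc n)
        1/x<1+n = [ (λ p → p) , ⊥-elim ∘ 1/[1+n]≤x ∘ n<1/x⇒x<1/n (ℕ.suc n) _ ]′
          (irrational#ι (1/-irrational x) (+ ℕ.suc n))
        k≤n : k ℕ.≤ n
        k≤n = ℕ.s≤s⁻¹ (ι-cancel-< (<-trans k<1/x 1/x<1+n))

  D? : ∀ x → Dec (D (value x))
  D? x = map′ (even⇒D x) (D⇒even x) (2 ∣? ⌊1/ x ⌋)

  module _ (x : Ω) where
    private
      f : Carrier
      f = frac1/ x

    abstract
      frac-irrational : Irrational f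
      frac-irrational = irrational-cong
        (+-cong (*-identityˡ _) (ι-neg (+ ⌊1/ x ⌋)))
        (irrational-affine (1/-irrational x) 1ℤ (-ᶻ + ⌊1/ x ⌋) (λ ()))

      1-frac-irrational : Irrational (1# - f)
      1-frac-irrational = irrational-cong
        (solve 1 (λ f → con -1ℤ :* f :+ con 1ℤ := con 1ℤ :- f) refl f)
        (irrational-affine frac-irrational -1ℤ 1ℤ (λ ()))

      0≤frac : 0# ≤ f
      0≤frac = <-asym (<⇒0<- (k<1/x x))

      frac≤1 : f ≤ 1#
      frac≤1 1<f = <-asym (1/x<1+k x) (0<-⇒< (<-respʳ
        (trans (solve 2 (λ y k → (y :- k) :- con 1ℤ := y :- (con 1ℤ :+ k)) refl (1/ x) (ι (+ ⌊1/ x ⌋)))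
          (+-congˡ (-‿cong (sym (ι-+ 1ℤ (+ ⌊1/ x ⌋)))))) (<⇒0<- 1<f)))

      0≤1-frac : 0# ≤ 1# - f
      0≤1-frac 1-f<0 = frac≤1 (0<-⇒< (<-respʳ
        (solve 1 (λ f → con 0ℤ :- (con 1ℤ :- f) := f :- con 1ℤ) refl f) (<⇒0<- 1-f<0)))

      1-frac≤1 : 1# - f ≤ 1#
      1-frac≤1 1<1-f = 0≤frac (0<-⇒< (<-respʳ
        (solve 1 (λ f → (con 1ℤ :- f) :- con 1ℤ := con 0ℤ :- f) refl f) (<⇒0<- 1<1-f)))

  e-D : Ω → ℤ
  e-D x with D? x
  ... | yes _ = -1ℤ
  ... | no  _ = 1ℤ

  a-D : Ω → ℤ
  a-D x with D? x
  ... | yes _ = 1ℤ +ᶻ + ⌊1/ x ⌋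
  ... | no  _ = + ⌊1/ x ⌋

  T-D : Ω → Ω
  T-D x with D? x
  ... | yes _ = mkΩ (1# - frac1/ x) (0≤1-frac x) (1-frac≤1 x) (1-frac-irrational x)
  ... | no  _ = mkΩ (frac1/ x) (0≤frac x) (frac≤1 x) (frac-irrational x)

  t : Ω → ℕ → Ω
  t x zero      = x
  t x (ℕ.suc n) = T-D (t x n)

  e : Ω → ℕ → ℤ
  e x zero      = 1ℤ
  e x (ℕ.suc n) = e-D (t x n)

  a : Ω → (n : ℕ) .{{_ : NonZero n}} → ℤ
  a x (ℕ.suc n) = a-D (t x n)

  -- The convergents start at index −1: p[ n -1] x is pₙ₋₁ and q[ n -1] x
  -- is qₙ₋₁.
  p[_-1] : ℕ → Ω → ℤ
  p[ 0 -1] x = 1ℤ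
  p[ 1 -1] x = 0ℤ
  p[ ℕ.suc (ℕ.suc n) -1] x = a x (ℕ.suc n) *ᶻ p[ ℕ.suc n -1] x +ᶻ e x n *ᶻ p[ n -1] x

  q[_-1] : ℕ → Ω → ℤ
  q[ 0 -1] x = 0ℤ
  q[ 1 -1] x = 1ℤ
  q[ ℕ.suc (ℕ.suc n) -1] x = a x (ℕ.suc n) *ᶻ q[ ℕ.suc n -1] x +ᶻ e x n *ᶻ q[ n -1] x

  SuccessiveConvergents : (P Q P′ Q′ : ℤ) → Ω → Set
  SuccessiveConvergents P Q P′ Q′ x = ∃[ n ] 1 ℕ.≤ n ×
    P  ≡ p[ n -1] x       × Q  ≡ q[ n -1] x ×
    P′ ≡ p[ ℕ.suc n -1] x × Q′ ≡ q[ ℕ.suc n -1] x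

  λᴹ : (M : Matrix) → Matrix.Q M ≢ 0ℤ → Carrier
  λᴹ M Q≢0 = ι (Matrix.Q′ M) ÷ ι (Matrix.Q M) [ ι#0 Q≢0 ]

  record 𝓡ₒ (M : Matrix) : Set ℓ₂ where
    open Matrix M
    field
      M∈GL₂ : M ∈GL₂[ℤ]
      0≤P   : 0ℤ ≤ᶻ P
      P≤Q   : P ≤ᶻ Q
      1≤P′  : 1ℤ ≤ᶻ P′
      P′≤Q′ : P′ ≤ᶻ Q′
      g<λ   : g < λᴹ M (Q≢0 M∈GL₂ 0≤P P≤Q)
      mod2  : M ≡ᴹ I [mod2] ⊎ M ≡ᴹ A [mod2] ⊎ M ≡ᴹ B [mod2]

  λ[_] : ∀ {M} → 𝓡ₒ M → Carrier
  λ[_] {M} r = λᴹ M (Q≢0 M∈GL₂ 0≤P P≤Q)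
    where open 𝓡ₒ r

  denominator#0 : ∀ M → M ∈GL₂[ℤ] → ∀ {x} → Irrational x →
                  - ι (Matrix.Q M) * x + ι (Matrix.P M) # 0#
  denominator#0 M M∈GL₂ irr = #-congʳ (+-congʳ (*-congʳ (ι-neg Q)))
    (irrational⇒linear#0 irr (-ᶻ Q) P
      (λ (-Q≡0 , P≡0) → column≢0 M∈GL₂ P≡0 (≡.trans (≡.sym (ℤ.neg-involutive Q)) (≡.cong -ᶻ_ -Q≡0))))
    where open Matrix M

  E : ∀ M → M ∈GL₂[ℤ] → ∀ x → Irrational x → Carrier
  E M M∈GL₂ x irr = (ι Q′ * x - ι P′) ÷ (- ι Q * x + ι P) [ denominator#0 M M∈GL₂ irr ]
    where open Matrix M

  E[_] : ∀ {M} → 𝓡ₒ M → Ω → Carrier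
  E[_] {M} r x = E M (𝓡ₒ.M∈GL₂ r) (value x) (irrational x)

  Condition∗ : ∀ {M} → 𝓡ₒ M → Ω → Set ℓ₂
  Condition∗ r x = 2# + g < λ[ r ] × 0# < ∣ E[ r ] x ∣ × ∣ E[ r ] x ∣ < 1#

  Condition∗∗ : ∀ {M} → 𝓡ₒ M → Ω → Set ℓ₂
  Condition∗∗ r x = g < λ[ r ] × λ[ r ] ≤ 2# + g × 0# < E[ r ] x × E[ r ] x < 1#

{-# OPTIONS --safe #-}
module Submission where

open import Data.Empty using (⊥; ⊥-elim)
open import Data.Integer.Base using (ℤ; +_; -[1+_]; 0ℤ; 1ℤ; -1ℤ; ∣_∣; +≤+) renaming (_+_ to _+ᶻ_; _*_ to _*ᶻ_; -_ to -ᶻ_; _-_ to _-ᶻ_; _≤_ to _≤ᶻ_)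
open import Data.Integer.Divisibility using () renaming (_∣_ to _∣ᶻ_)
open import Data.Integer.Divisibility.Signed using (divides; ∣ᵤ⇒∣; ∣⇒∣ᵤ)
open import Data.Integer.Tactic.RingSolver using (solve-∀)
open import Data.Nat.Base as ℕ using (ℕ; z≤n)
open import Data.Nat.Divisibility using (_∣_; _∣?_; m∣m*n; ∣m+n∣m⇒∣n)
open import Data.Product.Base using (Σ-syntax; ∃-syntax; _×_; _,_; proj₁; proj₂)
open import Data.Sum.Base using (_⊎_; inj₁; inj₂; [_,_]′)
open import Function.Base using (_∘_)
open import Function.Bundles using (_⇔_; mk⇔)
open import Level using () renaming (_⊔_ to _⊔ˡ_)
open import Relation.Binary.PropositionalEquality.Core as ≡ using (_≡_; _≢_)
open import Relation.Nullary using (¬_; yes; no)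
open import Relation.Nullary.Decidable using (from-no)
import Data.Integer.Properties as ℤ
import Data.Nat.Properties as ℕ
open import Defs

-- A pair of successive convergents is tracked together with its tail
-- y = E_M(x), that is x = (P′ + P y)/(Q′ + Q y).  For the n-th pair of the
-- expansion the tail is eₙ tₙ.  Appending a digit (e, a), a sign and a
-- partial quotient, sends each row (X, X′) to (X′, aX′ + eX), and the old
-- tail y and the new tail y′ are related by y = e/(a + y′).  Write λ = Q′/Q,
-- so that the new value of λ is a + e/λ.
--
-- After clearing denominators, (ii) says that M with tail y = E_M(x) is
-- admissible: M satisfies the arithmetic conditions (Reduced), λ > g, and
-- either 0 < y < 1, or −1 < y < 0 and λ > 2 + g
-- (condition⇒admissible, admissible⇒condition).
--
-- (i) ⇒ (ii): the first pair is admissible, and a digit of the expansion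
-- preserves admissibility (admissible-step, convergents-admissible).  If
-- e = 1 then a + e/λ > a.  If e = −1 then y < 0, so λ > 2 + g and
-- 1/λ < 1 − g by (2 + g)(1 − g) = 1.  In both cases a + e/λ > a − 1 + g,
-- which is g for a = 1 and at least 2 + g for a ≥ 3; and a = 1 is followed
-- by a positive tail.
--
-- (ii) ⇒ (i): descent on Q + Q′ (admissible⇒convergents).  If P = 0, then M
-- is the first pair, with the odd partial quotient Q′.  Otherwise the intervals
-- (a − 1 + g, a + 1 + g) with a odd cover (g, ∞) up to the points n + g
-- with n > 0 even, which λ never equals: R − gQ is a factor of the norm
-- R² + RQ − Q², and this is odd for R = Q′ − nQ because M is congruent to
-- I, A or B modulo 2.  So λ determines a, and e is the sign of λ − a,
-- which does not vanish when P > 0.  Removing this digit gives an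
-- admissible pair with smaller Q + Q′ (predecessor), which is the n-th pair
-- for some n.  Its tail is unique, so e = eₙ and 1/tₙ = a + y, and a is
-- then the partial quotient of tₙ because a is odd and y lies in the admissible range
-- (digit-unique).

-- Inequalities between integers

-- Most inequalities below are proved by certificates: a quantity is
-- nonnegative because a ring identity exhibits it as a sum of products of
-- nonnegative ones, and a contradiction is such an expression for −1.

0≤+ : ∀ {i j} → 0ℤ ≤ᶻ i → 0ℤ ≤ᶻ j → 0ℤ ≤ᶻ i +ᶻ j
0≤+ = ℤ.+-mono-≤

0≤* : ∀ {i j} → 0ℤ ≤ᶻ i → 0ℤ ≤ᶻ j → 0ℤ ≤ᶻ i *ᶻ j
0≤* {+ m} {+ n} _ _ = ≡.subst (0ℤ ≤ᶻ_) (ℤ.pos-* m n) (+≤+ z≤n)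

0≤-cong : ∀ {i j} → i ≡ j → 0ℤ ≤ᶻ i → 0ℤ ≤ᶻ j
0≤-cong = ≡.subst (0ℤ ≤ᶻ_)

0≤+n : ∀ {n} → 0ℤ ≤ᶻ + n
0≤+n = +≤+ z≤n

diff : ∀ {i j} → i ≤ᶻ j → 0ℤ ≤ᶻ j -ᶻ i
diff = ℤ.i≤j⇒0≤j-i

undiff : ∀ {i j} → 0ℤ ≤ᶻ j -ᶻ i → i ≤ᶻ j
undiff = ℤ.0≤i-j⇒j≤i

0≰-1 : ∀ {i} → i ≡ -1ℤ → ¬ 0ℤ ≤ᶻ i
0≰-1 ≡.refl ()

sign-dichotomy : ∀ i → 0ℤ ≤ᶻ i ⊎ 0ℤ ≤ᶻ -1ℤ -ᶻ i
sign-dichotomy (+ n)    = inj₁ 0≤+n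
sign-dichotomy -[1+ n ] = inj₂ 0≤+n

0≡⊎1≤ : ∀ {i} → 0ℤ ≤ᶻ i → i ≡ 0ℤ ⊎ 1ℤ ≤ᶻ i
0≡⊎1≤ {+ ℕ.zero}  _ = inj₁ ≡.refl
0≡⊎1≤ {+ ℕ.suc n} _ = inj₂ (+≤+ (ℕ.s≤s z≤n))

-- An integer i with iq > −q is nonnegative.
0≤-cancel : ∀ i q → 0ℤ ≤ᶻ q → 0ℤ ≤ᶻ i *ᶻ q +ᶻ (q -ᶻ 1ℤ) → 0ℤ ≤ᶻ i
0≤-cancel i q 0≤q h with sign-dichotomy i
... | inj₁ 0≤i = 0≤i
... | inj₂ i<0 = ⊥-elim (0≰-1 (ring i q) (0≤+ (0≤* i<0 0≤q) h))
  where
  ring : ∀ i q → (-1ℤ -ᶻ i) *ᶻ q +ᶻ (i *ᶻ q +ᶻ (q -ᶻ 1ℤ)) ≡ -1ℤ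
  ring = solve-∀

-- The units of ℤ, which serve both as signs e and as determinants
IsUnit : ℤ → Set
IsUnit i = i ≡ 1ℤ ⊎ i ≡ -1ℤ

∣i∣≡1⇒unit : ∀ i → ∣ i ∣ ≡ 1 → IsUnit i
∣i∣≡1⇒unit (+ n)    ≡.refl = inj₁ ≡.refl
∣i∣≡1⇒unit -[1+ n ] ≡.refl = inj₂ ≡.refl

unit-* : ∀ {i j} → IsUnit i → IsUnit j → IsUnit (i *ᶻ j)
unit-* (inj₁ ≡.refl) (inj₁ ≡.refl) = inj₁ ≡.refl
unit-* (inj₁ ≡.refl) (inj₂ ≡.refl) = inj₂ ≡.refl
unit-* (inj₂ ≡.refl) (inj₁ ≡.refl) = inj₂ ≡.refl
unit-* (inj₂ ≡.refl) (inj₂ ≡.refl) = inj₁ ≡.refl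

unit-factorʳ : ∀ i j → IsUnit (i *ᶻ j) → IsUnit j
unit-factorʳ i j u = ∣i∣≡1⇒unit j (ℕ.m*n≡1⇒n≡1 ∣ i ∣ ∣ j ∣
  (≡.trans (≡.sym (ℤ.abs-* i j)) ([ ≡.cong ∣_∣ , ≡.cong ∣_∣ ]′ u)))

unit-square : ∀ {i} → IsUnit i → i *ᶻ i ≡ 1ℤ
unit-square (inj₁ ≡.refl) = ≡.refl
unit-square (inj₂ ≡.refl) = ≡.refl

unit≤1 : ∀ {i} → IsUnit i → 0ℤ ≤ᶻ 1ℤ -ᶻ i
unit≤1 (inj₁ ≡.refl) = 0≤+n
unit≤1 (inj₂ ≡.refl) = 0≤+n

unit-1≤ : ∀ {i} → 1ℤ ≤ᶻ i → IsUnit i → i ≡ 1ℤ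
unit-1≤ _  (inj₁ i≡1)    = i≡1
unit-1≤ () (inj₂ ≡.refl)

-- Determinants

det : Matrix → ℤ
det (matrix P P′ Q Q′) = P *ᶻ Q′ -ᶻ P′ *ᶻ Q

GL₂⇒det-unit : ∀ M → M ∈GL₂[ℤ] → IsUnit (det M)
GL₂⇒det-unit M@(matrix a b c d) (N@(matrix a′ b′ c′ d′) , NM≡I , _) =
  unit-factorʳ (det N) (det M) (inj₁ (≡.trans (multiplicative a b c d a′ b′ c′ d′) (≡.cong det NM≡I)))
  where
  multiplicative : ∀ a b c d a′ b′ c′ d′ → (a′ *ᶻ d′ -ᶻ b′ *ᶻ c′) *ᶻ (a *ᶻ d -ᶻ b *ᶻ c) ≡
    (a′ *ᶻ a +ᶻ b′ *ᶻ c) *ᶻ (c′ *ᶻ b +ᶻ d′ *ᶻ d) -ᶻ (a′ *ᶻ b +ᶻ b′ *ᶻ d) *ᶻ (c′ *ᶻ a +ᶻ d′ *ᶻ c)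
  multiplicative = solve-∀

matrix-cong : ∀ {a a′ b b′ c c′ d d′} → a ≡ a′ → b ≡ b′ → c ≡ c′ → d ≡ d′ → matrix a b c d ≡ matrix a′ b′ c′ d′
matrix-cong ≡.refl ≡.refl ≡.refl ≡.refl = ≡.refl

-- When δ = det M is a unit, δ times the adjugate is the inverse of M.
det-unit⇒GL₂ : ∀ M → IsUnit (det M) → M ∈GL₂[ℤ]
det-unit⇒GL₂ M@(matrix a b c d) u =
  matrix (δ *ᶻ d) (-ᶻ (δ *ᶻ b)) (-ᶻ (δ *ᶻ c)) (δ *ᶻ a) ,
  matrix-cong (≡.trans (l₁ a b c d δ) δ²) (l₂ b d δ) (l₃ a c δ) (≡.trans (l₄ a b c d δ) δ²) ,
  matrix-cong (≡.trans (r₁ a b c d δ) δ²) (r₂ a b δ) (r₃ c d δ) (≡.trans (r₄ a b c d δ) δ²)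
  where
  δ : ℤ
  δ = det M
  δ² : δ *ᶻ (a *ᶻ d -ᶻ b *ᶻ c) ≡ 1ℤ
  δ² = unit-square u
  l₁ : ∀ a b c d δ → δ *ᶻ d *ᶻ a +ᶻ (-ᶻ (δ *ᶻ b)) *ᶻ c ≡ δ *ᶻ (a *ᶻ d -ᶻ b *ᶻ c)
  l₁ = solve-∀
  l₂ : ∀ b d δ → δ *ᶻ d *ᶻ b +ᶻ (-ᶻ (δ *ᶻ b)) *ᶻ d ≡ 0ℤ
  l₂ = solve-∀
  l₃ : ∀ a c δ → (-ᶻ (δ *ᶻ c)) *ᶻ a +ᶻ δ *ᶻ a *ᶻ c ≡ 0ℤ
  l₃ = solve-∀
  l₄ : ∀ a b c d δ → (-ᶻ (δ *ᶻ c)) *ᶻ b +ᶻ δ *ᶻ a *ᶻ d ≡ δ *ᶻ (a *ᶻ d -ᶻ b *ᶻ c)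
  l₄ = solve-∀
  r₁ : ∀ a b c d δ → a *ᶻ (δ *ᶻ d) +ᶻ b *ᶻ (-ᶻ (δ *ᶻ c)) ≡ δ *ᶻ (a *ᶻ d -ᶻ b *ᶻ c)
  r₁ = solve-∀
  r₂ : ∀ a b δ → a *ᶻ (-ᶻ (δ *ᶻ b)) +ᶻ b *ᶻ (δ *ᶻ a) ≡ 0ℤ
  r₂ = solve-∀
  r₃ : ∀ c d δ → c *ᶻ (δ *ᶻ d) +ᶻ d *ᶻ (-ᶻ (δ *ᶻ c)) ≡ 0ℤ
  r₃ = solve-∀
  r₄ : ∀ a b c d δ → c *ᶻ (-ᶻ (δ *ᶻ b)) +ᶻ d *ᶻ (δ *ᶻ a) ≡ δ *ᶻ (a *ᶻ d -ᶻ b *ᶻ c)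
  r₄ = solve-∀

-- Congruences modulo 2

-- Congruence modulo 2 with explicit quotient; a record, so that i and j
-- can be inferred from a proof.
record _≡₂_ (i j : ℤ) : Set where
  constructor even-difference
  field
    quotient : ℤ
    equality : i ≡ j +ᶻ + 2 *ᶻ quotient

∣⇒≡₂ : ∀ i j → + 2 ∣ᶻ i -ᶻ j → i ≡₂ j
∣⇒≡₂ i j 2∣i-j with ∣ᵤ⇒∣ {+ 2} {i -ᶻ j} 2∣i-j
... | divides q i-j≡q2 = even-difference q (≡.trans (ring₁ i j) (≡.trans (≡.cong (j +ᶻ_) i-j≡q2) (ring₂ j q)))
  where
  ring₁ : ∀ i j → i ≡ j +ᶻ (i -ᶻ j)
  ring₁ = solve-∀
  ring₂ : ∀ j q → j +ᶻ q *ᶻ + 2 ≡ j +ᶻ + 2 *ᶻ q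
  ring₂ = solve-∀

≡₂⇒∣ : ∀ {i j} → i ≡₂ j → + 2 ∣ᶻ i -ᶻ j
≡₂⇒∣ {_} {j} (even-difference q ≡.refl) = ∣⇒∣ᵤ (divides q (ring j q))
  where
  ring : ∀ j q → j +ᶻ + 2 *ᶻ q -ᶻ j ≡ q *ᶻ + 2
  ring = solve-∀

1≢₂0 : ¬ 1ℤ ≡₂ 0ℤ
1≢₂0 h = from-no (2 ∣? 1) (≡₂⇒∣ h)

≡₂-reflexive : ∀ {i j} → i ≡ j → i ≡₂ j
≡₂-reflexive {i} ≡.refl = even-difference 0ℤ (≡.sym (ℤ.+-identityʳ i))

≡₂-sym : ∀ {i j} → i ≡₂ j → j ≡₂ i
≡₂-sym {_} {j} (even-difference q ≡.refl) = even-difference (-ᶻ q) (ring j q)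
  where
  ring : ∀ j q → j ≡ j +ᶻ + 2 *ᶻ q +ᶻ + 2 *ᶻ (-ᶻ q)
  ring = solve-∀

≡₂-trans : ∀ {i j k} → i ≡₂ j → j ≡₂ k → i ≡₂ k
≡₂-trans {k = k} (even-difference q ≡.refl) (even-difference r ≡.refl) = even-difference (q +ᶻ r) (ring k q r)
  where
  ring : ∀ k q r → k +ᶻ + 2 *ᶻ r +ᶻ + 2 *ᶻ q ≡ k +ᶻ + 2 *ᶻ (q +ᶻ r)
  ring = solve-∀

≡₂-+ : ∀ {i i′ j j′} → i ≡₂ i′ → j ≡₂ j′ → (i +ᶻ j) ≡₂ (i′ +ᶻ j′)
≡₂-+ {_} {i′} {_} {j′} (even-difference q ≡.refl) (even-difference r ≡.refl) =
  even-difference (q +ᶻ r) (ring i′ j′ q r)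
  where
  ring : ∀ i j q r → i +ᶻ + 2 *ᶻ q +ᶻ (j +ᶻ + 2 *ᶻ r) ≡ i +ᶻ j +ᶻ + 2 *ᶻ (q +ᶻ r)
  ring = solve-∀

≡₂-* : ∀ {i i′ j j′} → i ≡₂ i′ → j ≡₂ j′ → (i *ᶻ j) ≡₂ (i′ *ᶻ j′)
≡₂-* {_} {i′} {_} {j′} (even-difference q ≡.refl) (even-difference r ≡.refl) =
  even-difference (i′ *ᶻ r +ᶻ q *ᶻ j′ +ᶻ + 2 *ᶻ q *ᶻ r) (ring i′ j′ q r)
  where
  ring : ∀ i j q r → (i +ᶻ + 2 *ᶻ q) *ᶻ (j +ᶻ + 2 *ᶻ r) ≡
    i *ᶻ j +ᶻ + 2 *ᶻ (i *ᶻ r +ᶻ q *ᶻ j +ᶻ + 2 *ᶻ q *ᶻ r)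
  ring = solve-∀

-- Signs are irrelevant modulo 2.
≡₂-neg : ∀ {i j} → i ≡₂ j → (-ᶻ i) ≡₂ j
≡₂-neg {_} {j} (even-difference q ≡.refl) = even-difference (-ᶻ (j +ᶻ q)) (ring j q)
  where
  ring : ∀ j q → -ᶻ (j +ᶻ + 2 *ᶻ q) ≡ j +ᶻ + 2 *ᶻ (-ᶻ (j +ᶻ q))
  ring = solve-∀

unit≡₂1 : ∀ {e} → IsUnit e → e ≡₂ 1ℤ
unit≡₂1 (inj₁ e≡1)    = ≡₂-reflexive e≡1
unit≡₂1 (inj₂ ≡.refl) = even-difference -1ℤ ≡.refl

-- The odd positive integer 2k + 1
odd : ℕ → ℤ
odd k = 1ℤ +ᶻ + 2 *ᶻ + k

odd≡₂1 : ∀ k → odd k ≡₂ 1ℤ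
odd≡₂1 k = even-difference (+ k) ≡.refl

≡₂1⇒odd : ∀ i → 0ℤ ≤ᶻ i → i ≡₂ 1ℤ → ∃[ k ] i ≡ odd k
≡₂1⇒odd i 0≤i (even-difference (+ k)    i≡) = k , i≡
≡₂1⇒odd i 0≤i (even-difference -[1+ k ] i≡) =
  ⊥-elim (0≰-1 (ring (+ k)) (0≤+ (0≤-cong i≡ 0≤i) (0≤* {+ 2} {+ k} 0≤+n 0≤+n)))
  where
  ring : ∀ k → 1ℤ +ᶻ + 2 *ᶻ (-ᶻ (1ℤ +ᶻ k)) +ᶻ + 2 *ᶻ k ≡ -1ℤ
  ring = solve-∀

-- M is congruent to the matrix with rows (p  p′) and (q  q′) modulo 2.
record Congruent (M : Matrix) (p p′ q q′ : ℤ) : Set where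
  constructor congruent
  open Matrix M
  field
    P≡₂p   : P ≡₂ p
    P′≡₂p′ : P′ ≡₂ p′
    Q≡₂q   : Q ≡₂ q
    Q′≡₂q′ : Q′ ≡₂ q′

-- M is congruent to I, A or B modulo 2.
data Residue (M : Matrix) : Set where
  ≡I : Congruent M 1ℤ 0ℤ 0ℤ 1ℤ → Residue M
  ≡A : Congruent M 0ℤ 1ℤ 1ℤ 1ℤ → Residue M
  ≡B : Congruent M 1ℤ 1ℤ 1ℤ 0ℤ → Residue M

mod2⇒residue : ∀ M → M ≡ᴹ I [mod2] ⊎ M ≡ᴹ A [mod2] ⊎ M ≡ᴹ B [mod2] → Residue M
mod2⇒residue M (inj₁ (p , p′ , q , q′)) =
  ≡I (congruent (∣⇒≡₂ _ 1ℤ p) (∣⇒≡₂ _ 0ℤ p′) (∣⇒≡₂ _ 0ℤ q) (∣⇒≡₂ _ 1ℤ q′))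
mod2⇒residue M (inj₂ (inj₁ (p , p′ , q , q′))) =
  ≡A (congruent (∣⇒≡₂ _ 0ℤ p) (∣⇒≡₂ _ 1ℤ p′) (∣⇒≡₂ _ 1ℤ q) (∣⇒≡₂ _ 1ℤ q′))
mod2⇒residue M (inj₂ (inj₂ (p , p′ , q , q′))) =
  ≡B (congruent (∣⇒≡₂ _ 1ℤ p) (∣⇒≡₂ _ 1ℤ p′) (∣⇒≡₂ _ 1ℤ q) (∣⇒≡₂ _ 0ℤ q′))

residue⇒mod2 : ∀ {M} → Residue M → M ≡ᴹ I [mod2] ⊎ M ≡ᴹ A [mod2] ⊎ M ≡ᴹ B [mod2]
residue⇒mod2 (≡I (congruent p p′ q q′)) = inj₁ (≡₂⇒∣ p , ≡₂⇒∣ p′ , ≡₂⇒∣ q , ≡₂⇒∣ q′)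
residue⇒mod2 (≡A (congruent p p′ q q′)) = inj₂ (inj₁ (≡₂⇒∣ p , ≡₂⇒∣ p′ , ≡₂⇒∣ q , ≡₂⇒∣ q′))
residue⇒mod2 (≡B (congruent p p′ q q′)) = inj₂ (inj₂ (≡₂⇒∣ p , ≡₂⇒∣ p′ , ≡₂⇒∣ q , ≡₂⇒∣ q′))

-- Appending and removing a digit

-- The pair of successive convergents that follows M when e is the current
-- sign and a the next partial quotient; (e, a) is called a digit.
step : (e a : ℤ) → Matrix → Matrix
step e a (matrix P P′ Q Q′) = matrix P′ (a *ᶻ P′ +ᶻ e *ᶻ P) Q′ (a *ᶻ Q′ +ᶻ e *ᶻ Q)

-- The entry X⁻ that precedes X, X′ in their row, X′ = aX + eX⁻, for e = ±1.
unstep : (e a X X′ : ℤ) → ℤ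
unstep e a X X′ = e *ᶻ (X′ -ᶻ a *ᶻ X)

step-unstep : ∀ {e} → IsUnit e → ∀ a X X′ → X′ ≡ a *ᶻ X +ᶻ e *ᶻ unstep e a X X′
step-unstep (inj₁ ≡.refl) = ring
  where
  ring : ∀ a X X′ → X′ ≡ a *ᶻ X +ᶻ 1ℤ *ᶻ (1ℤ *ᶻ (X′ -ᶻ a *ᶻ X))
  ring = solve-∀
step-unstep (inj₂ ≡.refl) = ring
  where
  ring : ∀ a X X′ → X′ ≡ a *ᶻ X +ᶻ -1ℤ *ᶻ (-1ℤ *ᶻ (X′ -ᶻ a *ᶻ X))
  ring = solve-∀

-- Modulo 2 a step is multiplication by A on the right, which permutes
-- I, A and B cyclically.
residue-step : ∀ {M e} → IsUnit e → ∀ k → Residue M → Residue (step e (odd k) M)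
residue-step {M} {e} u k = λ where
    (≡I (congruent p p′ q q′)) → ≡A (congruent p′ (entry p p′) q′ (entry q q′))
    (≡A (congruent p p′ q q′)) → ≡B (congruent p′ (entry p p′) q′ (≡₂-trans (entry q q′) (even-difference 1ℤ ≡.refl)))
    (≡B (congruent p p′ q q′)) → ≡I (congruent p′ (≡₂-trans (entry p p′) (even-difference 1ℤ ≡.refl)) q′ (entry q q′))
  where
  entry : ∀ {X X′ x x′} → X ≡₂ x → X′ ≡₂ x′ → (odd k *ᶻ X′ +ᶻ e *ᶻ X) ≡₂ (1ℤ *ᶻ x′ +ᶻ 1ℤ *ᶻ x)
  entry h h′ = ≡₂-+ (≡₂-* (odd≡₂1 k) h′) (≡₂-* (unit≡₂1 u) h)

-- Removing a digit multiplies by the inverse of A, which is B modulo 2.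
residue-unstep : ∀ {P P′ Q Q′ e} → IsUnit e → ∀ k → Residue (matrix P P′ Q Q′) →
                 Residue (matrix (unstep e (odd k) P P′) P (unstep e (odd k) Q Q′) Q)
residue-unstep {e = e} u k = λ where
    (≡I (congruent p p′ q q′)) → ≡B (congruent (entry p p′) p (entry q q′) q)
    (≡A (congruent p p′ q q′)) → ≡I (congruent (entry p p′) p (≡₂-trans (entry q q′) (even-difference 1ℤ ≡.refl)) q)
    (≡B (congruent p p′ q q′)) → ≡A (congruent (≡₂-trans (entry p p′) (even-difference 1ℤ ≡.refl)) p (entry q q′) q)
  where
  entry : ∀ {X X′ x x′} → X ≡₂ x → X′ ≡₂ x′ → unstep e (odd k) X X′ ≡₂ (1ℤ *ᶻ (x′ +ᶻ 1ℤ *ᶻ x))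
  entry h h′ = ≡₂-* (unit≡₂1 u) (≡₂-+ h′ (≡₂-neg (≡₂-* (odd≡₂1 k) h)))

-- The conditions defining 𝓡ₒ except λ_M > g, with M ∈ GL₂(ℤ) expressed as
-- det M = ±1.
record Reduced (M : Matrix) : Set where
  open Matrix M
  field
    det-unit : IsUnit (det M)
    0≤P      : 0ℤ ≤ᶻ P
    P≤Q      : P ≤ᶻ Q
    1≤P′     : 1ℤ ≤ᶻ P′
    P′≤Q′    : P′ ≤ᶻ Q′
    residue  : Residue M

  0≤Q : 0ℤ ≤ᶻ Q
  0≤Q = ℤ.≤-trans 0≤P P≤Q

  0≤P′ : 0ℤ ≤ᶻ P′
  0≤P′ = ℤ.≤-trans 0≤+n 1≤P′

  1≤Q′ : 1ℤ ≤ᶻ Q′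
  1≤Q′ = ℤ.≤-trans 1≤P′ P′≤Q′

  0≤Q′ : 0ℤ ≤ᶻ Q′
  0≤Q′ = ℤ.≤-trans 0≤+n 1≤Q′

  1≤Q : 1ℤ ≤ᶻ Q
  1≤Q with 0≡⊎1≤ 0≤Q
  ... | inj₂ 1≤Q    = 1≤Q
  ... | inj₁ ≡.refl with ℤ.≤-antisym P≤Q 0≤P
  ...   | ≡.refl = ⊥-elim (0-not-unit (≡.subst IsUnit (ring P′ Q′) det-unit))
    where
    ring : ∀ P′ Q′ → 0ℤ *ᶻ Q′ -ᶻ P′ *ᶻ 0ℤ ≡ 0ℤ
    ring = solve-∀
    0-not-unit : ¬ IsUnit 0ℤ
    0-not-unit (inj₁ ())
    0-not-unit (inj₂ ())

-- A row (X, X′) whose determinant with (Q, Q′) is a unit grows strictly,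
-- unless X = 0, as soon as Q′ > 2Q.  It is used for X = P and X = Q − P.
growth : ∀ {X X′ Q Q′} → 0ℤ ≤ᶻ X → 1ℤ ≤ᶻ Q → + 2 *ᶻ Q +ᶻ 1ℤ ≤ᶻ Q′ →
         IsUnit (X *ᶻ Q′ -ᶻ X′ *ᶻ Q) → X ≡ 0ℤ ⊎ X +ᶻ 1ℤ ≤ᶻ X′
growth {X} {X′} {Q} {Q′} 0≤X 1≤Q 2Q<Q′ u with 0≡⊎1≤ 0≤X
... | inj₁ X≡0 = inj₁ X≡0
... | inj₂ 1≤X with sign-dichotomy (X′ -ᶻ (X +ᶻ 1ℤ))
...   | inj₁ X<X′ = inj₂ (undiff X<X′)
...   | inj₂ X′≤X = ⊥-elim (0≰-1 (ring X X′ Q Q′)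
        (0≤+ (0≤+ (0≤+ (0≤+ (unit≤1 u) (0≤* 0≤X (diff 2Q<Q′))) (0≤* X′≤X 0≤Q))
             (0≤* (diff 1≤X) 0≤Q)) (0≤+ (diff 1≤Q) (diff 1≤X))))
  where
  0≤Q : 0ℤ ≤ᶻ Q
  0≤Q = ℤ.≤-trans 0≤+n 1≤Q
  ring : ∀ X X′ Q Q′ → 1ℤ -ᶻ (X *ᶻ Q′ -ᶻ X′ *ᶻ Q) +ᶻ X *ᶻ (Q′ -ᶻ (+ 2 *ᶻ Q +ᶻ 1ℤ))
    +ᶻ (-1ℤ -ᶻ (X′ -ᶻ (X +ᶻ 1ℤ))) *ᶻ Q +ᶻ (X -ᶻ 1ℤ) *ᶻ Q +ᶻ ((Q -ᶻ 1ℤ) +ᶻ (X -ᶻ 1ℤ)) ≡ -1ℤ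
  ring = solve-∀

det-step : ∀ {e} → IsUnit e → ∀ a M → IsUnit (det M) → IsUnit (det (step e a M))
det-step {e} u a (matrix P P′ Q Q′) d = ≡.subst IsUnit (ring e a P P′ Q Q′) (unit-* (unit-* (inj₂ ≡.refl) u) d)
  where
  ring : ∀ e a P P′ Q Q′ → -1ℤ *ᶻ e *ᶻ (P *ᶻ Q′ -ᶻ P′ *ᶻ Q) ≡
    P′ *ᶻ (a *ᶻ Q′ +ᶻ e *ᶻ Q) -ᶻ (a *ᶻ P′ +ᶻ e *ᶻ P) *ᶻ Q′
  ring = solve-∀

-- The row (Q − P, Q′ − P′) also has a unit determinant with (Q, Q′).
det-complement : ∀ {P P′ Q Q′} → IsUnit (det (matrix P P′ Q Q′)) →
                 IsUnit ((Q -ᶻ P) *ᶻ Q′ -ᶻ (Q′ -ᶻ P′) *ᶻ Q)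
det-complement {P} {P′} {Q} {Q′} d = ≡.subst IsUnit (ring P P′ Q Q′) (unit-* (inj₂ ≡.refl) d)
  where
  ring : ∀ P P′ Q Q′ → -1ℤ *ᶻ (P *ᶻ Q′ -ᶻ P′ *ᶻ Q) ≡ (Q -ᶻ P) *ᶻ Q′ -ᶻ (Q′ -ᶻ P′) *ᶻ Q
  ring = solve-∀

-- The new entries are (a − 1)X′ + (X′ + eX) for X = P and X = Q − P; if
-- e = −1, they are bounded below by growth.
reduced-step : ∀ {M e} k → IsUnit e → (e ≡ -1ℤ → + 2 *ᶻ Matrix.Q M +ᶻ 1ℤ ≤ᶻ Matrix.Q′ M) →
               Reduced M → Reduced (step e (odd k) M)
reduced-step {M@(matrix P P′ Q Q′)} {e} k u 2Q<Q′ r = record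
  { det-unit = det-step u (odd k) M det-unit
  ; 0≤P      = 0≤P′
  ; P≤Q      = P′≤Q′
  ; 1≤P′     = undiff (0≤-cong (p-ring e (+ k) P P′)
                 (0≤+ (0≤* (0≤* {+ 2} 0≤+n 0≤k) 0≤P′) (numerator u 2Q<Q′)))
  ; P′≤Q′    = undiff (0≤-cong (c-ring e (+ k) P P′ Q Q′)
                 (0≤+ (0≤* (0≤* {+ 2} 0≤+n 0≤k) (diff P′≤Q′)) (complement u 2Q<Q′)))
  ; residue  = residue-step u k residue
  }
  where
  open Reduced r
  0≤k : 0ℤ ≤ᶻ + k
  0≤k = 0≤+n
  p-ring : ∀ e k P P′ → + 2 *ᶻ k *ᶻ P′ +ᶻ (P′ +ᶻ e *ᶻ P -ᶻ 1ℤ) ≡ (1ℤ +ᶻ + 2 *ᶻ k) *ᶻ P′ +ᶻ e *ᶻ P -ᶻ 1ℤ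
  p-ring = solve-∀
  c-ring : ∀ e k P P′ Q Q′ → + 2 *ᶻ k *ᶻ (Q′ -ᶻ P′) +ᶻ ((Q′ -ᶻ P′) +ᶻ e *ᶻ (Q -ᶻ P)) ≡
    (1ℤ +ᶻ + 2 *ᶻ k) *ᶻ Q′ +ᶻ e *ᶻ Q -ᶻ ((1ℤ +ᶻ + 2 *ᶻ k) *ᶻ P′ +ᶻ e *ᶻ P)
  c-ring = solve-∀

  numerator : ∀ {e} → IsUnit e → (e ≡ -1ℤ → + 2 *ᶻ Q +ᶻ 1ℤ ≤ᶻ Q′) → 0ℤ ≤ᶻ P′ +ᶻ e *ᶻ P -ᶻ 1ℤ
  numerator (inj₁ ≡.refl) _ = 0≤-cong (ring P P′) (0≤+ (diff 1≤P′) 0≤P)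
    where
    ring : ∀ P P′ → P′ -ᶻ 1ℤ +ᶻ P ≡ P′ +ᶻ 1ℤ *ᶻ P -ᶻ 1ℤ
    ring = solve-∀
  numerator (inj₂ ≡.refl) h with growth {P} {P′} 0≤P 1≤Q (h ≡.refl) det-unit
  ... | inj₁ ≡.refl = 0≤-cong (≡.cong (_-ᶻ 1ℤ) (≡.sym (ℤ.+-identityʳ P′))) (diff 1≤P′)
  ... | inj₂ P<P′   = 0≤-cong (ring P P′) (diff P<P′)
    where
    ring : ∀ P P′ → P′ -ᶻ (P +ᶻ 1ℤ) ≡ P′ +ᶻ -1ℤ *ᶻ P -ᶻ 1ℤ
    ring = solve-∀

  complement : ∀ {e} → IsUnit e → (e ≡ -1ℤ → + 2 *ᶻ Q +ᶻ 1ℤ ≤ᶻ Q′) → 0ℤ ≤ᶻ (Q′ -ᶻ P′) +ᶻ e *ᶻ (Q -ᶻ P)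
  complement (inj₁ ≡.refl) _ = 0≤+ (diff P′≤Q′) (0≤* {1ℤ} 0≤+n (diff P≤Q))
  complement (inj₂ ≡.refl) h
    with growth {Q -ᶻ P} {Q′ -ᶻ P′} (diff P≤Q) 1≤Q (h ≡.refl) (det-complement {P} {P′} det-unit)
  ... | inj₁ Q-P≡0 = 0≤-cong
    (≡.sym (≡.trans (≡.cong (λ d → (Q′ -ᶻ P′) +ᶻ -1ℤ *ᶻ d) Q-P≡0) (ℤ.+-identityʳ _)))
    (diff P′≤Q′)
  ... | inj₂ grows = 0≤-cong (ring (Q -ᶻ P) (Q′ -ᶻ P′)) (0≤+ {j = 1ℤ} (diff grows) 0≤+n)
    where
    ring : ∀ X X′ → X′ -ᶻ (X +ᶻ 1ℤ) +ᶻ 1ℤ ≡ X′ +ᶻ -1ℤ *ᶻ X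
    ring = solve-∀

unstep-linear : ∀ e a P P′ Q Q′ → unstep e a Q Q′ -ᶻ unstep e a P P′ ≡ unstep e a (Q -ᶻ P) (Q′ -ᶻ P′)
unstep-linear = ring
  where
  ring : ∀ e a P P′ Q Q′ → e *ᶻ (Q′ -ᶻ a *ᶻ Q) -ᶻ e *ᶻ (P′ -ᶻ a *ᶻ P) ≡ e *ᶻ (Q′ -ᶻ P′ -ᶻ a *ᶻ (Q -ᶻ P))
  ring = solve-∀

-- X⁻Q expressed through the determinant of (X, X′) and (Q, Q′)
unstep-det : ∀ e a X X′ Q Q′ → X *ᶻ unstep e a Q Q′ -ᶻ e *ᶻ (X *ᶻ Q′ -ᶻ X′ *ᶻ Q) ≡ unstep e a X X′ *ᶻ Q
unstep-det = ring
  where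
  ring : ∀ e a X X′ Q Q′ → X *ᶻ (e *ᶻ (Q′ -ᶻ a *ᶻ Q)) -ᶻ e *ᶻ (X *ᶻ Q′ -ᶻ X′ *ᶻ Q) ≡ e *ᶻ (X′ -ᶻ a *ᶻ X) *ᶻ Q
  ring = solve-∀

-- X⁻Q = XQ⁻ ∓ 1 forces X⁻ ≥ 0, once X ≥ 1 or Q ≥ 2.
unstep-0≤ : ∀ {e} → IsUnit e → ∀ a {X X′ Q Q′} → 1ℤ ≤ᶻ Q → 1ℤ ≤ᶻ unstep e a Q Q′ →
            IsUnit (X *ᶻ Q′ -ᶻ X′ *ᶻ Q) → 1ℤ ≤ᶻ X ⊎ (0ℤ ≤ᶻ X × + 2 ≤ᶻ Q) → 0ℤ ≤ᶻ unstep e a X X′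
unstep-0≤ {e} u a {X} {X′} {Q} {Q′} 1≤Q 1≤Q⁻ d h = 0≤-cancel _ Q (ℤ.≤-trans 0≤+n 1≤Q)
  (0≤-cong (≡.cong (_+ᶻ (Q -ᶻ 1ℤ)) (unstep-det e a X X′ Q Q′)) (bound h))
  where
  Q⁻ δ : ℤ
  Q⁻ = unstep e a Q Q′
  δ  = e *ᶻ (X *ᶻ Q′ -ᶻ X′ *ᶻ Q)
  0≤Q⁻ : 0ℤ ≤ᶻ Q⁻
  0≤Q⁻ = ℤ.≤-trans 0≤+n 1≤Q⁻
  0≤1-δ : 0ℤ ≤ᶻ 1ℤ -ᶻ δ
  0≤1-δ = unit≤1 (unit-* u d)
  ring₁ : ∀ X Q Q⁻ δ → (X -ᶻ 1ℤ) *ᶻ Q⁻ +ᶻ (Q⁻ -ᶻ 1ℤ) +ᶻ (1ℤ -ᶻ δ) +ᶻ (Q -ᶻ 1ℤ) ≡ X *ᶻ Q⁻ -ᶻ δ +ᶻ (Q -ᶻ 1ℤ)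
  ring₁ = solve-∀
  ring₂ : ∀ X Q Q⁻ δ → X *ᶻ Q⁻ +ᶻ (1ℤ -ᶻ δ) +ᶻ (Q -ᶻ + 2) ≡ X *ᶻ Q⁻ -ᶻ δ +ᶻ (Q -ᶻ 1ℤ)
  ring₂ = solve-∀
  bound : 1ℤ ≤ᶻ X ⊎ (0ℤ ≤ᶻ X × + 2 ≤ᶻ Q) → 0ℤ ≤ᶻ X *ᶻ Q⁻ -ᶻ δ +ᶻ (Q -ᶻ 1ℤ)
  bound (inj₂ (0≤X , 2≤Q)) = 0≤-cong (ring₂ X Q Q⁻ δ) (0≤+ (0≤+ (0≤* 0≤X 0≤Q⁻) 0≤1-δ) (diff 2≤Q))
  bound (inj₁ 1≤X) = 0≤-cong (ring₁ X Q Q⁻ δ) (0≤+ (0≤+ (0≤+ (0≤* (diff 1≤X) 0≤Q⁻) (diff 1≤Q⁻)) 0≤1-δ) (diff 1≤Q))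

reduced-unstep : ∀ {P P′ Q Q′ e} k → IsUnit e → Reduced (matrix P P′ Q Q′) → 1ℤ ≤ᶻ P →
                 1ℤ ≤ᶻ unstep e (odd k) Q Q′ → (e ≡ -1ℤ → + 2 *ᶻ unstep e (odd k) Q Q′ +ᶻ 1ℤ ≤ᶻ Q) →
                 Reduced (matrix (unstep e (odd k) P P′) P (unstep e (odd k) Q Q′) Q)
reduced-unstep {P} {P′} {Q} {Q′} {e} k u r 1≤P 1≤Q⁻ 2Q⁻<Q = record
  { det-unit = ≡.subst IsUnit (det-ring e (odd k) P P′ Q Q′) (unit-* (unit-* (inj₂ ≡.refl) u) det-unit)
  ; 0≤P      = unstep-0≤ u (odd k) {P} {P′} {Q} {Q′} 1≤Q 1≤Q⁻ det-unit (inj₁ 1≤P)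
  ; P≤Q      = undiff (0≤-cong (≡.sym (unstep-linear e (odd k) P P′ Q Q′)) (complement u 2Q⁻<Q))
  ; 1≤P′     = 1≤P
  ; P′≤Q′    = P≤Q
  ; residue  = residue-unstep u k residue
  }
  where
  open Reduced r
  Q⁻ : ℤ
  Q⁻ = unstep e (odd k) Q Q′
  det-ring : ∀ e a P P′ Q Q′ → -1ℤ *ᶻ e *ᶻ (P *ᶻ Q′ -ᶻ P′ *ᶻ Q) ≡
    e *ᶻ (P′ -ᶻ a *ᶻ P) *ᶻ Q -ᶻ P *ᶻ (e *ᶻ (Q′ -ᶻ a *ᶻ Q))
  det-ring = solve-∀
  from : 1ℤ ≤ᶻ Q -ᶻ P ⊎ (0ℤ ≤ᶻ Q -ᶻ P × + 2 ≤ᶻ Q) → 0ℤ ≤ᶻ unstep e (odd k) (Q -ᶻ P) (Q′ -ᶻ P′)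
  from = unstep-0≤ u (odd k) {Q -ᶻ P} {Q′ -ᶻ P′} {Q} {Q′} 1≤Q 1≤Q⁻ (det-complement {P} {P′} det-unit)
  -- When P = Q and e = 1 the new difference is Q′ − P′ itself; when e = −1
  -- it is nonnegative because Q ≥ 2.
  complement : IsUnit e → (e ≡ -1ℤ → + 2 *ᶻ Q⁻ +ᶻ 1ℤ ≤ᶻ Q) → 0ℤ ≤ᶻ unstep e (odd k) (Q -ᶻ P) (Q′ -ᶻ P′)
  complement v h with 0≡⊎1≤ (diff P≤Q)
  ... | inj₂ 1≤Q-P = from (inj₁ 1≤Q-P)
  complement (inj₂ e≡-1) h | inj₁ _ = from (inj₂ (diff P≤Q , undiff (0≤-cong (ring Q Q⁻)
      (0≤+ (0≤+ (diff (h e≡-1)) (diff 1≤Q⁻)) (ℤ.≤-trans 0≤+n 1≤Q⁻)))))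
    where
    ring : ∀ Q Q⁻ → Q -ᶻ (+ 2 *ᶻ Q⁻ +ᶻ 1ℤ) +ᶻ (Q⁻ -ᶻ 1ℤ) +ᶻ Q⁻ ≡ Q -ᶻ + 2
    ring = solve-∀
  complement (inj₁ ≡.refl) h | inj₁ Q-P≡0 =
    0≤-cong (≡.trans (ring (odd k) (Q′ -ᶻ P′)) (≡.cong (λ d → unstep 1ℤ (odd k) d (Q′ -ᶻ P′)) (≡.sym Q-P≡0)))
      (diff P′≤Q′)
    where
    ring : ∀ a X → X ≡ 1ℤ *ᶻ (X -ᶻ a *ᶻ 0ℤ)
    ring = solve-∀

-- Reduced matrices with P = 0

reduced-first : ∀ k → Reduced (matrix 0ℤ 1ℤ 1ℤ (odd k))
reduced-first k = record
  { det-unit = inj₂ ≡.refl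
  ; 0≤P      = 0≤+n
  ; P≤Q      = 0≤+n
  ; 1≤P′     = ℤ.≤-refl
  ; P′≤Q′    = undiff (0≤-cong (ring (+ k)) (0≤* {+ 2} {+ k} 0≤+n 0≤+n))
  ; residue  = ≡A (congruent (≡₂-reflexive ≡.refl) (≡₂-reflexive ≡.refl) (≡₂-reflexive ≡.refl) (odd≡₂1 k))
  }
  where
  ring : ∀ k → + 2 *ᶻ k ≡ 1ℤ +ᶻ + 2 *ᶻ k -ᶻ 1ℤ
  ring = solve-∀

-- The reduced matrices with P = 0 are those of p₀/q₀ = 0/1, p₁/q₁ = 1/a₁
-- with a₁ odd.
P≡0⇒first : ∀ {P′ Q Q′} → Reduced (matrix 0ℤ P′ Q Q′) → P′ ≡ 1ℤ × Q ≡ 1ℤ × ∃[ k ] Q′ ≡ odd k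
P≡0⇒first {P′} {Q} {Q′} r = P′≡1 , Q≡1 , Q′-odd residue
  where
  open Reduced r
  ring : ∀ P′ Q Q′ → -1ℤ *ᶻ (0ℤ *ᶻ Q′ -ᶻ P′ *ᶻ Q) ≡ P′ *ᶻ Q
  ring = solve-∀
  P′Q-unit : IsUnit (P′ *ᶻ Q)
  P′Q-unit = ≡.subst IsUnit (ring P′ Q Q′) (unit-* (inj₂ ≡.refl) det-unit)
  Q≡1 : Q ≡ 1ℤ
  Q≡1 = unit-1≤ 1≤Q (unit-factorʳ P′ Q P′Q-unit)
  P′≡1 : P′ ≡ 1ℤ
  P′≡1 = unit-1≤ 1≤P′ (unit-factorʳ Q P′ (≡.subst IsUnit (ℤ.*-comm P′ Q) P′Q-unit))
  Q′-odd : Residue (matrix 0ℤ P′ Q Q′) → ∃[ k ] Q′ ≡ odd k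
  Q′-odd (≡I m) = ⊥-elim (1≢₂0 (≡.subst (_≡₂ 0ℤ) Q≡1 (Congruent.Q≡₂q m)))
  Q′-odd (≡A m) = ≡₂1⇒odd Q′ 0≤Q′ (Congruent.Q′≡₂q′ m)
  Q′-odd (≡B m) = ⊥-elim (1≢₂0 (≡₂-sym (Congruent.P≡₂p m)))

-- If P ≥ 1 then Q′ is not an odd multiple of Q: this would make P and Q
-- equal to 1 and Q′ odd, against the residues.
odd-multiple⇒P≡0 : ∀ {P P′ Q Q′} → Reduced (matrix P P′ Q Q′) → ∀ k → Q′ ≡ odd k *ᶻ Q → P ≡ 0ℤ
odd-multiple⇒P≡0 {P} {P′} {Q} {Q′} r k Q′≡aQ with 0≡⊎1≤ (Reduced.0≤P r)
... | inj₁ P≡0 = P≡0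
... | inj₂ 1≤P = ⊥-elim (contradiction residue)
  where
  open Reduced r
  ring : ∀ a P P′ Q → P *ᶻ (a *ᶻ Q) -ᶻ P′ *ᶻ Q ≡ (P *ᶻ a -ᶻ P′) *ᶻ Q
  ring = solve-∀
  Q≡1 : Q ≡ 1ℤ
  Q≡1 = unit-1≤ 1≤Q (unit-factorʳ (P *ᶻ odd k -ᶻ P′) Q
    (≡.subst IsUnit (≡.trans (≡.cong (λ q → P *ᶻ q -ᶻ P′ *ᶻ Q) Q′≡aQ) (ring (odd k) P P′ Q)) det-unit))
  P≡1 : P ≡ 1ℤ
  P≡1 = ℤ.≤-antisym (≡.subst (P ≤ᶻ_) Q≡1 P≤Q) 1≤P
  contradiction : Residue (matrix P P′ Q Q′) → ⊥
  contradiction (≡I m) = 1≢₂0 (≡.subst (_≡₂ 0ℤ) Q≡1 (Congruent.Q≡₂q m))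
  contradiction (≡A m) = 1≢₂0 (≡.subst (_≡₂ 0ℤ) P≡1 (Congruent.P≡₂p m))
  contradiction (≡B m) = 1≢₂0 (≡₂-trans (≡₂-sym (≡₂-trans (≡₂-reflexive Q′≡aQ)
    (≡₂-* (odd≡₂1 k) (Congruent.Q≡₂q m)))) (Congruent.Q′≡₂q′ m))

-- Q′ − 2nQ is apart from gQ

-- The norm of R − gQ in ℤ[g]: R² + RQ − Q² = (R − gQ)(R + Q + gQ).
norm : ℤ → ℤ → ℤ
norm Q R = R *ᶻ R +ᶻ R *ᶻ Q -ᶻ Q *ᶻ Q

-- The norm is odd unless Q and R are both even, and the bottom rows of I,
-- A and B exclude this for R ≡ Q′ modulo 2.
norm≢0 : ∀ {M} → Residue M → ∀ n → norm (Matrix.Q M) (Matrix.Q′ M -ᶻ + 2 *ᶻ n *ᶻ Matrix.Q M) ≢ 0ℤ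
norm≢0 {matrix _ _ Q Q′} m n = λ norm≡0 → 1≢₂0 (≡₂-trans (≡₂-sym (norm≡₂1 m)) (≡₂-reflexive norm≡0))
  where
  ring : ∀ n Q Q′ → Q′ -ᶻ + 2 *ᶻ n *ᶻ Q ≡ Q′ +ᶻ + 2 *ᶻ (-ᶻ (n *ᶻ Q))
  ring = solve-∀
  R≡₂Q′ : (Q′ -ᶻ + 2 *ᶻ n *ᶻ Q) ≡₂ Q′
  R≡₂Q′ = even-difference (-ᶻ (n *ᶻ Q)) (ring n Q Q′)
  norm-cong : ∀ {q q′} → Q ≡₂ q → Q′ ≡₂ q′ →
              norm Q (Q′ -ᶻ + 2 *ᶻ n *ᶻ Q) ≡₂ (q′ *ᶻ q′ +ᶻ q′ *ᶻ q +ᶻ q *ᶻ q)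
  norm-cong h h′ = ≡₂-+ (≡₂-+ (≡₂-* R≡ R≡) (≡₂-* R≡ h)) (≡₂-neg (≡₂-* h h))
    where R≡ = ≡₂-trans R≡₂Q′ h′
  norm≡₂1 : Residue (matrix _ _ Q Q′) → norm Q (Q′ -ᶻ + 2 *ᶻ n *ᶻ Q) ≡₂ 1ℤ
  norm≡₂1 (≡I c) = norm-cong (Congruent.Q≡₂q c) (Congruent.Q′≡₂q′ c)
  norm≡₂1 (≡A c) = ≡₂-trans (norm-cong (Congruent.Q≡₂q c) (Congruent.Q′≡₂q′ c)) (even-difference 1ℤ ≡.refl)
  norm≡₂1 (≡B c) = norm-cong (Congruent.Q≡₂q c) (Congruent.Q′≡₂q′ c)

module _ {c ℓ₁ ℓ₂} (R : Reals c ℓ₁ ℓ₂) where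
  open Reals R renaming (∣_∣ to abs)
  open OCF R

  -- Order and the embedding of ℤ

  0<-cong : ∀ {x y} → x ≈ y → 0# < x → 0# < y
  0<-cong = <-respʳ

  -- u < v, from a positive expression w for the difference v − u
  <-by : ∀ {u v w} → w ≈ v - u → 0# < w → u < v
  <-by w≈v-u 0<w = 0<-⇒< (0<-cong w≈v-u 0<w)

  neg-pos : ∀ {x} → 0# < x → - x < 0#
  neg-pos 0<x = <-respʳ -0#≈0# (neg-mono-< 0<x)

  neg⇒0<- : ∀ {x} → x < 0# → 0# < - x
  neg⇒0<- x<0 = <-respˡ -0#≈0# (neg-mono-< x<0)

  *-cancelʳ-<-pos : ∀ {u v q} → 0# < q → u * q < v * q → u < v
  *-cancelʳ-<-pos {u} {v} {q} 0<q uq<vq =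
    <-respˡ (unit u) (<-respʳ (unit v) (*-monoˡ-<-pos (inverse-pos q*q⁻¹ 0<q) uq<vq))
    where
    q⁻¹ : Carrier
    q⁻¹ = q ⁻¹[ inj₂ 0<q ]
    q*q⁻¹ : q * q⁻¹ ≈ 1#
    q*q⁻¹ = ⁻¹-inverseʳ q (inj₂ 0<q)
    unit : ∀ z → z * q * q⁻¹ ≈ z
    unit z = trans (*-assoc z q q⁻¹) (trans (*-congˡ q*q⁻¹) (*-identityʳ z))

  1≤⇒0<ι : ∀ {m} → 1ℤ ≤ᶻ m → 0# < ι m
  1≤⇒0<ι {+ ℕ.suc n} _ = ι-pos n
  1≤⇒0<ι {+ ℕ.zero} (+≤+ ())

  0<ι⇒1≤ : ∀ {m} → 0# < ι m → 1ℤ ≤ᶻ m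
  0<ι⇒1≤ {+ ℕ.zero}  0<0 = ⊥-elim (<-irrefl refl 0<0)
  0<ι⇒1≤ {+ ℕ.suc n} _   = +≤+ (ℕ.s≤s z≤n)
  0<ι⇒1≤ { -[1+ n ]} 0<m = ⊥-elim (<-asym 0<m (neg-pos (ι-pos n)))

  ι-sub : ∀ m n → ι (m -ᶻ n) ≈ ι m - ι n
  ι-sub m n = trans (ι-+ m (-ᶻ n)) (+-congˡ (ι-neg n))

  ι-odd : ∀ k → ι (odd k) ≈ 1# + 2# * ι (+ k)
  ι-odd k = trans (ι-+ 1ℤ (+ 2 *ᶻ + k)) (+-congˡ (ι-* (+ 2) (+ k)))

  ι-odd-suc : ∀ k → ι (odd (ℕ.suc k)) ≈ 1# + 2# * (1# + ι (+ k))
  ι-odd-suc k = trans (ι-odd (ℕ.suc k)) (+-congˡ (*-congˡ (ι-+ 1ℤ (+ k))))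

  -x≈-1*x : ∀ x → - x ≈ ι -1ℤ * x
  -x≈-1*x = solve 1 (λ x → :- x := con -1ℤ :* x) refl

  ι-combination : ∀ a X e Y → ι (a *ᶻ X +ᶻ e *ᶻ Y) ≈ ι a * ι X + ι e * ι Y
  ι-combination a X e Y = trans (ι-+ (a *ᶻ X) (e *ᶻ Y)) (+-cong (ι-* a X) (ι-* e Y))

  -- ι(n)·y + z is positive for n ∈ ℕ and y, z > 0.
  nonneg-combination : ∀ n {y z} → 0# < y → 0# < z → 0# < ι (+ n) * y + z
  nonneg-combination ℕ.zero    {y} {z} 0<y 0<z = 0<-cong (solve 2 (λ y z → z := con 0ℤ :* y :+ z) refl y z) 0<z
  nonneg-combination (ℕ.suc n) 0<y 0<z = +-pos (*-pos (ι-pos n) 0<y) 0<z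

  -- Arithmetic of g

  -- One half
  h : Carrier
  h = 2# ⁻¹[ 2#0 ]

  2h≈1 : 2# * h ≈ 1#
  2h≈1 = ⁻¹-inverseʳ 2# 2#0

  0<h : 0# < h
  0<h = inverse-pos 2h≈1 (ι-pos 1)

  abstract
    -- Writing g = (√5 − 1) h, with 1 = 2h inserted to make g² + g a multiple
    -- of h².
    g²+g≈1 : g * g + g ≈ 1#
    g²+g≈1 = trans (+-congˡ (trans (sym (*-identityʳ g)) (*-congˡ (sym 2h≈1))))
      (trans (solve 2 (λ s h → (s :- con 1ℤ) :* h :* ((s :- con 1ℤ) :* h) :+ (s :- con 1ℤ) :* h :* (con (+ 2) :* h)
                               := (s :* s :- con 1ℤ) :* (h :* h)) refl √5 h)
      (trans (*-congʳ (+-congʳ √5*√5≈5))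
      (trans (solve 1 (λ h → (con (+ 5) :- con 1ℤ) :* (h :* h) := con (+ 2) :* h :* (con (+ 2) :* h)) refl h)
      (trans (*-cong 2h≈1 2h≈1) (*-identityʳ 1#)))))

    0<1+g : 0# < 1# + g
    0<1+g = 0<-cong
      (trans (solve 2 (λ s h → (s :+ con 1ℤ) :* h := con (+ 2) :* h :+ (s :- con 1ℤ) :* h) refl √5 h) (+-congʳ 2h≈1))
      (*-pos (+-pos 0<√5 0<1) 0<h)

    g*[1+g]≈1 : g * (1# + g) ≈ 1#
    g*[1+g]≈1 = trans (solve 1 (λ g → g :* (con 1ℤ :+ g) := g :* g :+ g) refl g) g²+g≈1

    0<g : 0# < g
    0<g = inverse-pos (trans (*-comm (1# + g) g) g*[1+g]≈1) 0<1+g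

    0<2+g : 0# < 2# + g
    0<2+g = +-pos (ι-pos 1) 0<g

    [2+g][1-g]≈1 : (2# + g) * (1# - g) ≈ 1#
    [2+g][1-g]≈1 = trans (solve 1 (λ g → (con (+ 2) :+ g) :* (con 1ℤ :- g) := con (+ 2) :- (g :* g :+ g)) refl g)
      (trans (+-congˡ (-‿cong g²+g≈1)) (solve 0 (con (+ 2) :- con 1ℤ := con 1ℤ) refl))

    0<1-g : 0# < 1# - g
    0<1-g = inverse-pos [2+g][1-g]≈1 0<2+g

    norm-factor : ∀ Q R → ι (norm Q R) ≈ (ι R - g * ι Q) * (ι R + ι Q + g * ι Q)
    norm-factor Q R = trans (ι-sub (R *ᶻ R +ᶻ R *ᶻ Q) (Q *ᶻ Q))
      (trans (+-cong (ι-combination R R R Q)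
        (-‿cong (trans (ι-* Q Q) (trans (sym (*-identityˡ _)) (*-congʳ (sym g²+g≈1))))))
      (solve 3 (λ g Q R → R :* R :+ R :* Q :- (g :* g :+ g) :* (Q :* Q)
                        := (R :- g :* Q) :* (R :+ Q :+ g :* Q)) refl g (ι Q) (ι R)))

    norm≢0⇒# : ∀ Q R → norm Q R ≢ 0ℤ → ι R # g * ι Q
    norm≢0⇒# Q R norm≢0 = -#0⇒# (xy#0⇒x#0 (#-congʳ (norm-factor Q R) (ι#0 norm≢0)))

  -- Tails

  -- y = E_M(x), without division
  Tail : Matrix → Carrier → Carrier → Set ℓ₁
  Tail (matrix P P′ Q Q′) x y = y * (- ι Q * x + ι P) ≈ ι Q′ * x - ι P′

  E-tail : ∀ M (M∈GL₂ : M ∈GL₂[ℤ]) x (irr : Irrational x) → Tail M x (E M M∈GL₂ x irr)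
  E-tail M M∈GL₂ x irr = trans (*-assoc _ _ _)
    (trans (*-congˡ (trans (*-comm _ _) (⁻¹-inverseʳ _ (denominator#0 M M∈GL₂ irr)))) (*-identityʳ _))

  cancel-# : ∀ {u v d} → d # 0# → u * d ≈ v * d → u ≈ v
  cancel-# {u} {v} {d} d#0 ud≈vd = trans (sym (unit u)) (trans (*-congʳ ud≈vd) (unit v))
    where
    unit : ∀ z → z * d * d ⁻¹[ d#0 ] ≈ z
    unit z = trans (*-assoc z d _) (trans (*-congˡ (⁻¹-inverseʳ d d#0)) (*-identityʳ z))

  tail-unique : ∀ M → M ∈GL₂[ℤ] → ∀ {x} → Irrational x → ∀ {y z} → Tail M x y → Tail M x z → y ≈ z
  tail-unique M M∈GL₂ irr ty tz = cancel-# (denominator#0 M M∈GL₂ irr) (trans ty (sym tz))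

  -- Appending the digit (e, a) replaces the tail y by y′ with
  -- y = e/(a + y′).
  tail-step : ∀ M e a {x y y′} → y * (ι a + y′) ≈ ι e →
              Tail M x y → Tail (step e a M) x y′
  tail-step (matrix P P′ Q Q′) e a {x} {y} {y′} y[a+y′]≈e ty = trans
    (solve 5 (λ y′ P′ Q′ x a
        → y′ :* (:- Q′ :* x :+ P′) := :- ((a :+ y′) :* (Q′ :* x :- P′)) :+ a :* (Q′ :* x :- P′))
      refl y′ (ι P′) (ι Q′) x (ι a))
    (trans (+-congʳ (-‿cong (trans (*-congˡ (sym ty)) (trans (sym (*-assoc _ _ _))
      (*-congʳ (trans (*-comm _ _) y[a+y′]≈e))))))
    (trans (solve 7 (λ e P P′ Q Q′ x a → :- (e :* (:- Q :* x :+ P)) :+ a :* (Q′ :* x :- P′)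
                       := (a :* Q′ :+ e :* Q) :* x :- (a :* P′ :+ e :* P))
      refl (ι e) (ι P) (ι P′) (ι Q) (ι Q′) x (ι a))
    (sym (+-cong (*-congʳ (ι-combination a Q′ e Q)) (-‿cong (ι-combination a P′ e P))))))

  -- The converse, with r = 1/(a + y′)
  tail-unstep : ∀ M e a {x r y′} → r * (ι a + y′) ≈ 1# →
                Tail (step e a M) x y′ → Tail M x (ι e * r)
  tail-unstep (matrix P P′ Q Q′) e a {x} {r} {y′} r[a+y′]≈1 ty′ = trans
    (solve 3 (λ e r D → e :* r :* D := r :* (e :* D)) refl (ι e) r den)
    (trans (*-congˡ e*den≈)
    (trans (sym (*-assoc _ _ _)) (trans (*-congʳ r[a+y′]≈1) (*-identityˡ num))))
    where
    den num : Carrier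
    den = - ι Q * x + ι P
    num = ι Q′ * x - ι P′
    ty″ : y′ * (- ι Q′ * x + ι P′) ≈ (ι a * ι Q′ + ι e * ι Q) * x - (ι a * ι P′ + ι e * ι P)
    ty″ = trans ty′ (+-cong (*-congʳ (ι-combination a Q′ e Q)) (-‿cong (ι-combination a P′ e P)))
    e*den≈ : ι e * den ≈ (ι a + y′) * num
    e*den≈ = trans
      (solve 7 (λ e P P′ Q Q′ x a → e :* (:- Q :* x :+ P)
          := a :* (Q′ :* x :- P′) :- ((a :* Q′ :+ e :* Q) :* x :- (a :* P′ :+ e :* P)))
        refl (ι e) (ι P) (ι P′) (ι Q) (ι Q′) x (ι a))
      (trans (+-congˡ (-‿cong (sym ty″)))
      (solve 5 (λ y′ a P′ Q′ x → a :* (Q′ :* x :- P′) :- y′ :* (:- Q′ :* x :+ P′) := (a :+ y′) :* (Q′ :* x :- P′))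
        refl y′ (ι a) (ι P′) (ι Q′) x))

  -- Admissible pairs

  -- The conditions on y = E_M(x) in (ii), regrouped by the sign of y
  Range : Matrix → Carrier → Set ℓ₂
  Range (matrix P P′ Q Q′) y = (0# < y × y < 1#) ⊎ (- 1# < y × y < 0# × (2# + g) * ι Q < ι Q′)

  -- Condition (ii) for M and y = E_M(x), with g < λ_M cleared of its
  -- denominator
  record Admissible (M : Matrix) (x y : Carrier) : Set (ℓ₁ ⊔ˡ ℓ₂) where
    field
      reduced : Reduced M
      gQ<Q′   : g * ι (Matrix.Q M) < ι (Matrix.Q′ M)
      tail    : Tail M x y
      range   : Range M y

  -- The residual Q′ − 2nQ, in whose terms λ_M > 2n + g reads gQ < Q′ − 2nQ
  residual : Matrix → ℤ → ℤ
  residual M n = Matrix.Q′ M -ᶻ + 2 *ᶻ n *ᶻ Matrix.Q M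

  ι-residual : ∀ M n → ι (residual M n) ≈ ι (Matrix.Q′ M) - 2# * ι n * ι (Matrix.Q M)
  ι-residual (matrix _ _ Q Q′) n =
    trans (ι-sub Q′ _) (+-congˡ (-‿cong (trans (ι-* (+ 2 *ᶻ n) Q) (*-congʳ (ι-* (+ 2) n)))))

  ι-residual-0 : ∀ M → ι (residual M 0ℤ) ≈ ι (Matrix.Q′ M)
  ι-residual-0 M@(matrix _ _ Q Q′) = trans (ι-residual M 0ℤ)
    (solve 2 (λ q q′ → q′ :- con (+ 2) :* con 0ℤ :* q := q′) refl (ι Q) (ι Q′))

  residual#gQ : ∀ {M} → Residue M → ∀ n → ι (residual M n) # g * ι (Matrix.Q M)
  residual#gQ {M} m n = norm≢0⇒# (Matrix.Q M) (residual M n) (norm≢0 m n)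

  -- λ_M is apart from 2 + g, which decides between the two cases of (ii).
  compare-2+g : ∀ {M} → Residue M → ι (Matrix.Q′ M) # (2# + g) * ι (Matrix.Q M)
  compare-2+g {M@(matrix P P′ Q Q′)} m = -#0⇒# (#-congʳ lemma (#⇒-#0 (residual#gQ m 1ℤ)))
    where
    lemma : ι (residual M 1ℤ) - g * ι Q ≈ ι Q′ - (2# + g) * ι Q
    lemma = trans (+-congʳ (ι-residual M 1ℤ))
      (solve 3 (λ g Q Q′ → Q′ :- con (+ 2) :* con 1ℤ :* Q :- g :* Q
                        := Q′ :- (con (+ 2) :+ g) :* Q) refl g (ι Q) (ι Q′))

  abs-<1 : ∀ {y} → y # 0# → - 1# < y → y < 1# → 0# < abs y × abs y < 1#
  abs-<1 {y} (inj₁ y<0) -1<y _ =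
    <-≤-trans 0<-y (proj₁ (proj₂ (⊔-supremum y (- y)))) ,
    ≤-<-trans (proj₂ (proj₂ (⊔-supremum y (- y))) (- y) (<-asym (<-trans y<0 0<-y)) (<-irrefl refl))
      (<-respʳ (-‿involutive 1#) (neg-mono-< -1<y))
    where
    0<-y : 0# < - y
    0<-y = neg⇒0<- y<0
  abs-<1 {y} (inj₂ 0<y) _ y<1 =
    <-≤-trans 0<y (proj₁ (⊔-supremum y (- y))) ,
    ≤-<-trans (proj₂ (proj₂ (⊔-supremum y (- y))) y (<-irrefl refl) (<-asym (<-trans (neg-pos 0<y) 0<y))) y<1

  abs-<1⁻¹ : ∀ {y} → abs y < 1# → - 1# < y × y < 1#
  abs-<1⁻¹ {y} |y|<1 =
    <-respʳ (-‿involutive y) (neg-mono-< (≤-<-trans (proj₁ (proj₂ (⊔-supremum y (- y)))) |y|<1)) ,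
    ≤-<-trans (proj₁ (⊔-supremum y (- y))) |y|<1

  λ-equation : ∀ M Q≢0 → λᴹ M Q≢0 * ι (Matrix.Q M) ≈ ι (Matrix.Q′ M)
  λ-equation M Q≢0 = trans (*-assoc _ _ _)
    (trans (*-congˡ (trans (*-comm _ _) (⁻¹-inverseʳ _ (ι#0 Q≢0)))) (*-identityʳ _))

  <λ⇒ : ∀ M Q≢0 → 1ℤ ≤ᶻ Matrix.Q M → ∀ {u} → u < λᴹ M Q≢0 → u * ι (Matrix.Q M) < ι (Matrix.Q′ M)
  <λ⇒ M Q≢0 1≤Q u<λ = <-respʳ (λ-equation M Q≢0) (*-monoˡ-<-pos (1≤⇒0<ι 1≤Q) u<λ)

  ⇒<λ : ∀ M Q≢0 → 1ℤ ≤ᶻ Matrix.Q M → ∀ {u} → u * ι (Matrix.Q M) < ι (Matrix.Q′ M) → u < λᴹ M Q≢0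
  ⇒<λ M Q≢0 1≤Q uQ<Q′ = *-cancelʳ-<-pos (1≤⇒0<ι 1≤Q) (<-respʳ (sym (λ-equation M Q≢0)) uQ<Q′)

  𝓡ₒ⇒reduced : ∀ {M} → 𝓡ₒ M → Reduced M
  𝓡ₒ⇒reduced {M} r = record
    { det-unit = GL₂⇒det-unit M M∈GL₂ ; 0≤P = 0≤P ; P≤Q = P≤Q ; 1≤P′ = 1≤P′ ; P′≤Q′ = P′≤Q′
    ; residue = mod2⇒residue M mod2 }
    where open 𝓡ₒ r

  reduced⇒𝓡ₒ : ∀ {M} → Reduced M → g * ι (Matrix.Q M) < ι (Matrix.Q′ M) → 𝓡ₒ M
  reduced⇒𝓡ₒ {M} r gQ<Q′ = record
    { M∈GL₂ = M∈GL₂ ; 0≤P = 0≤P ; P≤Q = P≤Q ; 1≤P′ = 1≤P′ ; P′≤Q′ = P′≤Q′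
    ; g<λ = ⇒<λ M (Q≢0 M∈GL₂ 0≤P P≤Q) 1≤Q gQ<Q′ ; mod2 = residue⇒mod2 residue }
    where
    open Reduced r
    M∈GL₂ : M ∈GL₂[ℤ]
    M∈GL₂ = det-unit⇒GL₂ M det-unit

  condition⇒admissible : ∀ {M} (r : 𝓡ₒ M) (x : Ω) → Condition∗ r x ⊎ Condition∗∗ r x →
                         Admissible M (value x) (E[ r ] x)
  condition⇒admissible {M@(matrix P P′ Q Q′)} r x condition = record
    { reduced = reduced
    ; gQ<Q′   = <λ⇒ M _ 1≤Q (𝓡ₒ.g<λ r)
    ; tail    = tail
    ; range   = range condition
    }
    where
    reduced : Reduced M
    reduced = 𝓡ₒ⇒reduced r
    open Reduced reduced using (1≤Q; 1≤P′)
    y : Carrier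
    y = E[ r ] x
    tail : Tail M (value x) y
    tail = E-tail M (𝓡ₒ.M∈GL₂ r) (value x) (irrational x)
    y#0 : y # 0#
    y#0 = xy#0⇒x#0 (#-congʳ (trans (+-congˡ (ι-neg P′)) (sym tail))
      (irrational⇒linear#0 (irrational x) Q′ (-ᶻ P′) λ (_ , -P′≡0) →
        P′≢0 (≡.trans (≡.sym (ℤ.neg-involutive P′)) (≡.cong -ᶻ_ -P′≡0))))
      where
      P′≢0 : P′ ≢ 0ℤ
      P′≢0 P′≡0 with ≡.subst (1ℤ ≤ᶻ_) P′≡0 1≤P′
      ... | +≤+ ()
    range : Condition∗ r x ⊎ Condition∗∗ r x → Range M y
    range (inj₂ (_ , _ , 0<y , y<1)) = inj₁ (0<y , y<1)
    range (inj₁ (2+g<λ , _ , |y|<1)) with y#0 | abs-<1⁻¹ |y|<1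
    ... | inj₁ y<0 | -1<y , _   = inj₂ (-1<y , y<0 , <λ⇒ M _ 1≤Q 2+g<λ)
    ... | inj₂ 0<y | _    , y<1 = inj₁ (0<y , y<1)

  -1<0 : - 1# < 0#
  -1<0 = neg-pos 0<1

  admissible⇒condition : ∀ {M} (x : Ω) {y} → Admissible M (value x) y →
                         Σ[ r ∈ 𝓡ₒ M ] (Condition∗ r x ⊎ Condition∗∗ r x)
  admissible⇒condition {M@(matrix P P′ Q Q′)} x {y} adm = r , condition range (compare-2+g residue)
    where
    open Admissible adm
    open Reduced reduced
    r : 𝓡ₒ M
    r = reduced⇒𝓡ₒ reduced gQ<Q′
    y≈E : y ≈ E[ r ] x
    y≈E = tail-unique M (𝓡ₒ.M∈GL₂ r) (irrational x) tail (E-tail M (𝓡ₒ.M∈GL₂ r) (value x) (irrational x))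
    large : (2# + g) * ι Q < ι Q′ → y # 0# → - 1# < y → y < 1# → Condition∗ r x
    large 2+gQ<Q′ y#0 -1<y y<1 = ⇒<λ M _ 1≤Q 2+gQ<Q′ ,
      abs-<1 (#-congʳ y≈E y#0) (<-respʳ y≈E -1<y) (<-respˡ y≈E y<1)
    condition : Range M y → ι Q′ # (2# + g) * ι Q → Condition∗ r x ⊎ Condition∗∗ r x
    condition (inj₂ (-1<y , y<0 , 2+gQ<Q′)) _ = inj₁ (large 2+gQ<Q′ (inj₁ y<0) -1<y (<-trans y<0 0<1))
    condition (inj₁ (0<y , y<1)) (inj₂ 2+gQ<Q′) = inj₁ (large 2+gQ<Q′ (inj₂ 0<y) (<-trans -1<0 0<y) y<1)
    condition (inj₁ (0<y , y<1)) (inj₁ Q′<2+gQ) = inj₂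
      ( 𝓡ₒ.g<λ r , (λ 2+g<λ → <-asym Q′<2+gQ (<λ⇒ M _ 1≤Q 2+g<λ)) , <-respʳ y≈E 0<y , <-respˡ y≈E y<1)

  -- Appending a digit to an admissible pair

  2+g⇒2Q<Q′ : ∀ {Q Q′} → 0ℤ ≤ᶻ Q → (2# + g) * ι Q < ι Q′ → + 2 *ᶻ Q +ᶻ 1ℤ ≤ᶻ Q′
  2+g⇒2Q<Q′ {Q@(+ n)} {Q′} 0≤Q 2+gQ<Q′ = undiff (0≤-cong (identity Q Q′) (diff (0<ι⇒1≤ {Q′ -ᶻ + 2 *ᶻ Q}
    (0<-cong (sym (trans (ι-sub Q′ (+ 2 *ᶻ Q)) (trans (+-congˡ (-‿cong (ι-* (+ 2) Q)))
      (solve 3 (λ g q q′ → q′ :- con (+ 2) :* q := q :* g :+ (q′ :- (con (+ 2) :+ g) :* q)) refl g (ι Q) (ι Q′)))))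
      (nonneg-combination n 0<g (<⇒0<- 2+gQ<Q′))))))
    where
    identity : ∀ Q Q′ → Q′ -ᶻ + 2 *ᶻ Q -ᶻ 1ℤ ≡ Q′ -ᶻ (+ 2 *ᶻ Q +ᶻ 1ℤ)
    identity = solve-∀

  -- If λ > 2 + g in case e = −1, then e/λ > g − 1.
  0<[1-g]Q′+eQ : ∀ {Q Q′ e} → IsUnit e → 1ℤ ≤ᶻ Q → 1ℤ ≤ᶻ Q′ → (e ≡ -1ℤ → (2# + g) * ι Q < ι Q′) →
                 0# < (1# - g) * ι Q′ + ι e * ι Q
  0<[1-g]Q′+eQ (inj₁ ≡.refl) 1≤Q 1≤Q′ _ = +-pos (*-pos 0<1-g (1≤⇒0<ι 1≤Q′)) (*-pos 0<1 (1≤⇒0<ι 1≤Q))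
  0<[1-g]Q′+eQ {Q} {Q′} (inj₂ ≡.refl) 1≤Q 1≤Q′ large = 0<-cong
    (trans (solve 3 (λ g q q′ → (con 1ℤ :- g) :* (q′ :- (con (+ 2) :+ g) :* q)
                       := (con 1ℤ :- g) :* q′ :- (con (+ 2) :+ g) :* (con 1ℤ :- g) :* q) refl g (ι Q) (ι Q′))
    (trans (+-congˡ (-‿cong (*-congʳ [2+g][1-g]≈1)))
      (solve 3 (λ g q q′ → (con 1ℤ :- g) :* q′ :- con 1ℤ :* q
                        := (con 1ℤ :- g) :* q′ :+ con -1ℤ :* q) refl g (ι Q) (ι Q′))))
    (*-pos 0<1-g (<⇒0<- (large ≡.refl)))

  -- The tails y′ that may follow the partial quotient a = 2k + 1: y′ < 0
  -- requires a ≥ 3.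
  DigitRange : ℕ → Carrier → Set ℓ₂
  DigitRange k y′ = (0# < y′ × y′ < 1#) ⊎ (- 1# < y′ × y′ < 0# × 1 ℕ.≤ k)

  -- With W = (1 − g)Q′ + eQ > 0 and Q″ = aQ′ + eQ, the two bounds are
  -- Q″ − gQ′ = (a − 1)Q′ + W and Q″ − (2 + g)Q′ = (a − 3)Q′ + W.
  admissible-step : ∀ {M x y y′ e} k → IsUnit e → Admissible M x y → y * (ι (odd k) + y′) ≈ ι e →
                    (e ≡ -1ℤ → y < 0#) → DigitRange k y′ → Admissible (step e (odd k) M) x y′
  admissible-step {M@(matrix P P′ Q Q′)} {x} {y} {y′} {e} k u adm y[a+y′]≈e y<0 digit = record
    { reduced = reduced-step k u (λ e≡-1 → 2+g⇒2Q<Q′ 0≤Q (large e≡-1)) reduced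
    ; gQ<Q′   = <-by (trans (solve 5 (λ g k q q′ e → k :* (con (+ 2) :* q′) :+ ((con 1ℤ :- g) :* q′ :+ e :* q)
                         := (con 1ℤ :+ con (+ 2) :* k) :* q′ :+ e :* q :- g :* q′) refl g (ι (+ k)) (ι Q) (ι Q′) (ι e))
                       (+-congʳ (sym Q″≈)))
                  (nonneg-combination k 0<2Q′ 0<W)
    ; tail    = tail-step M e (odd k) y[a+y′]≈e tail
    ; range   = range′ k Q″≈ digit
    }
    where
    open Admissible adm
    open Reduced reduced
    large : e ≡ -1ℤ → (2# + g) * ι Q < ι Q′
    large e≡-1 with range
    ... | inj₁ (0<y , _)     = ⊥-elim (<-asym 0<y (y<0 e≡-1))
    ... | inj₂ (_ , _ , 2+gQ<Q′) = 2+gQ<Q′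
    0<2Q′ : 0# < 2# * ι Q′
    0<2Q′ = *-pos (ι-pos 1) (1≤⇒0<ι 1≤Q′)
    0<W : 0# < (1# - g) * ι Q′ + ι e * ι Q
    0<W = 0<[1-g]Q′+eQ u 1≤Q 1≤Q′ large
    Q″≈ : ι (odd k *ᶻ Q′ +ᶻ e *ᶻ Q) ≈ (1# + 2# * ι (+ k)) * ι Q′ + ι e * ι Q
    Q″≈ = trans (ι-combination (odd k) Q′ e Q) (+-congʳ (*-congʳ (ι-odd k)))
    range′ : ∀ k → ι (odd k *ᶻ Q′ +ᶻ e *ᶻ Q) ≈ (1# + 2# * ι (+ k)) * ι Q′ + ι e * ι Q →
             DigitRange k y′ → Range (step e (odd k) M) y′
    range′ _ _ (inj₁ 0<y′<1) = inj₁ 0<y′<1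
    range′ (ℕ.suc k) eq (inj₂ (-1<y′ , y′<0 , _)) = inj₂ (-1<y′ , y′<0 ,
      <-by (trans (solve 5 (λ g k q q′ e → k :* (con (+ 2) :* q′) :+ ((con 1ℤ :- g) :* q′ :+ e :* q)
                 := (con 1ℤ :+ con (+ 2) :* (con 1ℤ :+ k)) :* q′ :+ e :* q :- (con (+ 2) :+ g) :* q′)
               refl g (ι (+ k)) (ι Q) (ι Q′) (ι e))
             (+-congʳ (sym (trans eq (+-congʳ (*-congʳ (+-congˡ (*-congˡ (ι-+ 1ℤ (+ k))))))))))
        (nonneg-combination k 0<2Q′ 0<W))

  -- Removing the last digit of an admissible pair

  -- The residual Q′ − 2kQ lies between gQ and (2 + g)Q, that is, λ_M lies
  -- between a − 1 + g and a + 1 + g for a = 2k + 1.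
  Window : Matrix → ℕ → Set ℓ₂
  Window M k = g * ι (Matrix.Q M) < ι (residual M (+ k)) × ι (residual M (+ k)) < (2# + g) * ι (Matrix.Q M)

  -- Downward search from n = Q′, where the residual is negative; the
  -- residuals for n and n + 1 differ by 2Q, so the first one to exceed gQ
  -- is below (2 + g)Q.
  find-window : ∀ {M} → Reduced M → g * ι (Matrix.Q M) < ι (Matrix.Q′ M) → ∃[ k ] Window M k
  find-window {M@(matrix P P′ Q Q′)} r gQ<Q′ = search ∣ Q′ ∣ start
    where
    open Reduced r
    identity : ∀ Q Q′ → + 2 *ᶻ Q′ *ᶻ (Q -ᶻ 1ℤ) +ᶻ (Q′ -ᶻ 1ℤ) ≡ -ᶻ (Q′ -ᶻ + 2 *ᶻ Q′ *ᶻ Q) -ᶻ 1ℤ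
    identity = solve-∀
    1≤-R : 1ℤ ≤ᶻ -ᶻ (residual M Q′)
    1≤-R = undiff (0≤-cong (identity Q Q′) (0≤+ (0≤* (0≤* {+ 2} 0≤+n 0≤Q′) (diff 1≤Q)) (diff 1≤Q′)))
    start : ι (residual M (+ ∣ Q′ ∣)) < g * ι Q
    start = ≡.subst (λ n → ι (residual M n) < g * ι Q) (≡.sym (ℤ.0≤i⇒+∣i∣≡i 0≤Q′))
      (<-trans (<-respˡ (-‿involutive _) (neg-pos (0<-cong (ι-neg (residual M Q′)) (1≤⇒0<ι 1≤-R))))
        (*-pos 0<g (1≤⇒0<ι 1≤Q)))
    search : ∀ n → ι (residual M (+ n)) < g * ι Q → ∃[ k ] Window M k
    search ℕ.zero R<gQ = ⊥-elim (<-asym gQ<Q′ (<-respˡ (ι-residual-0 M) R<gQ))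
    search (ℕ.suc n) R<gQ with residual#gQ residue (+ n)
    ... | inj₁ Rₙ<gQ = search n Rₙ<gQ
    ... | inj₂ gQ<Rₙ = n , gQ<Rₙ , <-by
      (trans (+-congˡ (-‿cong (trans (ι-residual M (+ ℕ.suc n)) (+-congˡ (-‿cong (*-congʳ (*-congˡ (ι-+ 1ℤ (+ n)))))))))
      (trans (solve 4 (λ g q q′ n → g :* q :- (q′ :- con (+ 2) :* (con 1ℤ :+ n) :* q)
                                 := (con (+ 2) :+ g) :* q :- (q′ :- con (+ 2) :* n :* q))
               refl g (ι Q) (ι Q′) (ι (+ n)))
        (+-congˡ (-‿cong (sym (ι-residual M (+ n)))))))
      (<⇒0<- R<gQ)

  -- The last digit (e⁻, 2k + 1): the bottom entry Q⁻ that precedes Q, Q′ is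
  -- positive, Q/Q⁻ satisfies the bounds that e⁻ imposes, and Q⁻ < Q′.
  record LastDigit (M : Matrix) : Set ℓ₂ where
    open Matrix M
    field
      k      : ℕ
      e⁻     : ℤ
      unit   : IsUnit e⁻
      window : Window M k
      1≤Q⁻   : 1ℤ ≤ᶻ unstep e⁻ (odd k) Q Q′
      gQ⁻<Q  : g * ι (unstep e⁻ (odd k) Q Q′) < ι Q
      large  : e⁻ ≡ -1ℤ → (2# + g) * ι (unstep e⁻ (odd k) Q Q′) < ι Q
      Q⁻<Q′  : unstep e⁻ (odd k) Q Q′ +ᶻ 1ℤ ≤ᶻ Q′

  -- The sign e⁻ is that of d = Q′ − aQ.  For d > 0, Q⁻ < (1 + g)Q gives
  -- gQ⁻ < Q by g(1 + g) = 1; for d < 0, Q⁻ < (1 − g)Q gives (2 + g)Q⁻ < Q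
  -- by (2 + g)(1 − g) = 1.
  last-digit : ∀ {M} → Reduced M → 1ℤ ≤ᶻ Matrix.P M → g * ι (Matrix.Q M) < ι (Matrix.Q′ M) → LastDigit M
  last-digit {M@(matrix P P′ Q Q′)} r 1≤P gQ<Q′ with find-window r gQ<Q′
  ... | k , gQ<R , R<2+gQ = digit (sign-dichotomy d)
    where
    open Reduced r
    a′ d : ℤ
    a′ = odd k
    d  = Q′ -ᶻ a′ *ᶻ Q
    identity₀ : ∀ a Q Q′ → Q′ -ᶻ a *ᶻ Q +ᶻ a *ᶻ Q ≡ Q′
    identity₀ = solve-∀
    d≢0 : d ≢ 0ℤ
    d≢0 d≡0 with ≡.subst (1ℤ ≤ᶻ_) (odd-multiple⇒P≡0 r k Q′≡aQ) 1≤P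
      where
      Q′≡aQ : Q′ ≡ a′ *ᶻ Q
      Q′≡aQ = ≡.trans (≡.sym (identity₀ a′ Q Q′)) (≡.trans (≡.cong (_+ᶻ a′ *ᶻ Q) d≡0) (ℤ.+-identityˡ _))
    ... | +≤+ ()
    identity₁ : ∀ k Q Q′ → Q′ -ᶻ (1ℤ +ᶻ + 2 *ᶻ k) *ᶻ Q ≡ Q′ -ᶻ + 2 *ᶻ k *ᶻ Q -ᶻ Q
    identity₁ = solve-∀
    ιd≈ : ι d ≈ ι (residual M (+ k)) - ι Q
    ιd≈ = trans (reflexive (≡.cong ι (identity₁ (+ k) Q Q′))) (ι-sub (residual M (+ k)) Q)

    digit : 0ℤ ≤ᶻ d ⊎ 0ℤ ≤ᶻ -1ℤ -ᶻ d → LastDigit M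
    digit (inj₁ 0≤d) = record
      { k = k ; e⁻ = 1ℤ ; unit = inj₁ ≡.refl ; window = gQ<R , R<2+gQ
      ; 1≤Q⁻   = ≡.subst (1ℤ ≤ᶻ_) (≡.sym (ℤ.*-identityˡ d)) 1≤d
      ; gQ⁻<Q  = <-by (trans (solve 3 (λ g q r → g :* ((con (+ 2) :+ g) :* q :- r)
                         := (g :* g :+ g) :* q :- g :* (r :- q)) refl g (ι Q) (ι (residual M (+ k))))
                   (+-cong (trans (*-congʳ g²+g≈1) (*-identityˡ _)) (-‿cong (*-congˡ (sym ιQ⁻≈)))))
                   (*-pos 0<g (<⇒0<- R<2+gQ))
      ; large  = λ ()
      ; Q⁻<Q′  = undiff (0≤-cong (identity (+ k) Q Q′) (0≤+ (0≤* (0≤* {+ 2} {+ k} 0≤+n 0≤+n) 0≤Q) (diff 1≤Q)))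
      }
      where
      1≤d : 1ℤ ≤ᶻ d
      1≤d = [ (λ d≡0 → ⊥-elim (d≢0 d≡0)) , (λ p → p) ]′ (0≡⊎1≤ 0≤d)
      ιQ⁻≈ : ι (1ℤ *ᶻ d) ≈ ι (residual M (+ k)) - ι Q
      ιQ⁻≈ = trans (reflexive (≡.cong ι (ℤ.*-identityˡ d))) ιd≈
      identity : ∀ k Q Q′ → + 2 *ᶻ k *ᶻ Q +ᶻ (Q -ᶻ 1ℤ) ≡ Q′ -ᶻ (1ℤ *ᶻ (Q′ -ᶻ (1ℤ +ᶻ + 2 *ᶻ k) *ᶻ Q) +ᶻ 1ℤ)
      identity = solve-∀
    digit (inj₂ d<0) = record
      { k = k ; e⁻ = -1ℤ ; unit = inj₂ ≡.refl ; window = gQ<R , R<2+gQ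
      ; 1≤Q⁻   = 1≤Q⁻
      ; gQ⁻<Q  = <-by (solve 3 (λ g q r → con (+ 2) :* r :+ (q :- (con (+ 2) :+ g) :* r)
                     := q :- g :* r) refl g (ι Q) (ι Q⁻))
                   (+-pos (*-pos (ι-pos 1) (1≤⇒0<ι 1≤Q⁻)) (<⇒0<- large))
      ; large  = λ _ → large
      ; Q⁻<Q′  = undiff (0≤-cong (identity (+ k) Q Q′)
                   (0≤+ (0≤* (0≤* {+ 2} {+ k} 0≤+n 0≤+n) 0≤Q) (diff 2Q⁻<Q)))
      }
      where
      Q⁻ : ℤ
      Q⁻ = -1ℤ *ᶻ d
      identity₂ : ∀ d → -1ℤ -ᶻ d ≡ -1ℤ *ᶻ d -ᶻ 1ℤ
      identity₂ = solve-∀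
      1≤Q⁻ : 1ℤ ≤ᶻ Q⁻
      1≤Q⁻ = undiff (0≤-cong (identity₂ d) d<0)
      ιQ⁻≈ : ι Q⁻ ≈ ι Q - ι (residual M (+ k))
      ιQ⁻≈ = trans (ι-* -1ℤ d) (trans (*-congˡ ιd≈)
        (solve 2 (λ q r → con -1ℤ :* (r :- q) := q :- r) refl (ι Q) (ι (residual M (+ k)))))
      large : (2# + g) * ι Q⁻ < ι Q
      large = <-by (trans (solve 3 (λ g q r → (con (+ 2) :+ g) :* (r :- g :* q)
                      := (con (+ 2) :+ g) :* (con 1ℤ :- g) :* q :- (con (+ 2) :+ g) :* (q :- r))
                    refl g (ι Q) (ι (residual M (+ k))))
                   (+-cong (trans (*-congʳ [2+g][1-g]≈1) (*-identityˡ _)) (-‿cong (*-congˡ (sym ιQ⁻≈)))))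
                (*-pos 0<2+g (<⇒0<- gQ<R))
      2Q⁻<Q : + 2 *ᶻ Q⁻ +ᶻ 1ℤ ≤ᶻ Q
      2Q⁻<Q = 2+g⇒2Q<Q′ (ℤ.≤-trans 0≤+n 1≤Q⁻) large
      identity : ∀ k Q Q′ →
        + 2 *ᶻ k *ᶻ Q +ᶻ (Q -ᶻ (+ 2 *ᶻ (-1ℤ *ᶻ (Q′ -ᶻ (1ℤ +ᶻ + 2 *ᶻ k) *ᶻ Q)) +ᶻ 1ℤ)) ≡
        Q′ -ᶻ (-1ℤ *ᶻ (Q′ -ᶻ (1ℤ +ᶻ + 2 *ᶻ k) *ᶻ Q) +ᶻ 1ℤ)
      identity = solve-∀

  -- The pair of which M is the successor with digit (e, a).
  unstepᴹ : (e a : ℤ) → Matrix → Matrix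
  unstepᴹ e a (matrix P P′ Q Q′) = matrix (unstep e a P P′) P (unstep e a Q Q′) Q

  step-unstepᴹ : ∀ {e} → IsUnit e → ∀ a M → M ≡ step e a (unstepᴹ e a M)
  step-unstepᴹ u a (matrix P P′ Q Q′) = matrix-cong ≡.refl (step-unstep u a P P′) ≡.refl (step-unstep u a Q Q′)

  -- A tail y < 0 forces λ_M > 2 + g, hence a last digit of at least 3.
  digit-range : ∀ {M} k → Window M k → ∀ {y} → Range M y → DigitRange k y
  digit-range k _ (inj₁ 0<y<1) = inj₁ 0<y<1
  digit-range (ℕ.suc k) _ (inj₂ (-1<y , y<0 , _)) = inj₂ (-1<y , y<0 , ℕ.s≤s z≤n)
  digit-range {M} ℕ.zero (_ , Q′<2+gQ) (inj₂ (_ , _ , 2+gQ<Q′)) =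
    ⊥-elim (<-asym 2+gQ<Q′ (<-respˡ (ι-residual-0 M) Q′<2+gQ))

  digit+tail>1 : ∀ {k y} → DigitRange k y → 1# < ι (odd k) + y
  digit+tail>1 {k} {y} (inj₁ (0<y , _)) = <-by
    (trans (solve 2 (λ k y → k :* con (+ 2) :+ y := con 1ℤ :+ con (+ 2) :* k :+ y :- con 1ℤ) refl (ι (+ k)) y)
      (+-congʳ (+-congʳ (sym (ι-odd k)))))
    (nonneg-combination k (ι-pos 1) 0<y)
  digit+tail>1 {ℕ.suc k} {y} (inj₂ (-1<y , _)) = <-by
    (trans (solve 2 (λ k y → k :* con (+ 2) :+ (con 1ℤ :+ (y :- con -1ℤ))
                      := con 1ℤ :+ con (+ 2) :* (con 1ℤ :+ k) :+ y :- con 1ℤ) refl (ι (+ k)) y)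
      (+-congʳ (+-congʳ (sym (ι-odd-suc k)))))
    (nonneg-combination k (ι-pos 1) (+-pos 0<1 (<⇒0<- -1<y)))

  -- The pair that precedes M, with tail e⁻ r for r = 1/(a + y)
  record Predecessor (M : Matrix) (x y : Carrier) : Set (c ⊔ˡ ℓ₁ ⊔ˡ ℓ₂) where
    field
      k          : ℕ
      e⁻         : ℤ
      unit       : IsUnit e⁻
      r          : Carrier
      0<r        : 0# < r
      r[a+y]≈1   : r * (ι (odd k) + y) ≈ 1#
      digit      : DigitRange k y
      admissible : Admissible (unstepᴹ e⁻ (odd k) M) x (ι e⁻ * r)
      Q⁻<Q′      : unstep e⁻ (odd k) (Matrix.Q M) (Matrix.Q′ M) +ᶻ 1ℤ ≤ᶻ Matrix.Q′ M

  predecessor : ∀ {M x y} → Admissible M x y → 1ℤ ≤ᶻ Matrix.P M → Predecessor M x y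
  predecessor {M@(matrix P P′ Q Q′)} {x} {y} adm 1≤P = record
    { k = k ; e⁻ = e⁻ ; unit = unit ; r = r ; 0<r = 0<r ; r[a+y]≈1 = r[a+y]≈1 ; digit = digit ; Q⁻<Q′ = Q⁻<Q′
    ; admissible = record
      { reduced = reduced-unstep k unit reduced 1≤P 1≤Q⁻ (λ e≡-1 → 2+g⇒2Q<Q′ (ℤ.≤-trans 0≤+n 1≤Q⁻) (large e≡-1))
      ; gQ<Q′   = gQ⁻<Q
      ; tail    = tail-unstep (unstepᴹ e⁻ (odd k) M) e⁻ (odd k) r[a+y]≈1
                    (≡.subst (λ N → Tail N x y) (step-unstepᴹ unit (odd k) M) tail)
      ; range   = range⁻ unit large
      }
    }
    where
    open Admissible adm
    ld : LastDigit M
    ld = last-digit reduced 1≤P gQ<Q′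
    open LastDigit ld
    s : Carrier
    s = ι (odd k) + y
    digit : DigitRange k y
    digit = digit-range {M} k window range
    1<s : 1# < s
    1<s = digit+tail>1 digit
    0<s : 0# < s
    0<s = <-trans 0<1 1<s
    r : Carrier
    r = s ⁻¹[ inj₂ 0<s ]
    s*r≈1 : s * r ≈ 1#
    s*r≈1 = ⁻¹-inverseʳ s (inj₂ 0<s)
    r[a+y]≈1 : r * s ≈ 1#
    r[a+y]≈1 = trans (*-comm r s) s*r≈1
    0<r : 0# < r
    0<r = inverse-pos s*r≈1 0<s
    r<1 : r < 1#
    r<1 = inverse-anti-mono-< (*-identityʳ 1#) s*r≈1 0<1 0<r 1<s
    range⁻ : ∀ {e} → IsUnit e → (e ≡ -1ℤ → (2# + g) * ι (unstep e⁻ (odd k) Q Q′) < ι Q) →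
             Range (unstepᴹ e⁻ (odd k) M) (ι e * r)
    range⁻ (inj₁ ≡.refl) _ = inj₁ (<-respʳ 1r 0<r , <-respˡ 1r r<1)
      where
      1r : r ≈ 1# * r
      1r = sym (*-identityˡ r)
    range⁻ (inj₂ ≡.refl) large = inj₂
      (<-respʳ (-x≈-1*x r) (neg-mono-< r<1) , <-respˡ (-x≈-1*x r) (neg-pos 0<r) , large ≡.refl)

  -- Digits of the expansion

  parity : ∀ n → (∃[ k ] n ≡ 2 ℕ.* k) ⊎ (∃[ k ] n ≡ 1 ℕ.+ 2 ℕ.* k)
  parity ℕ.zero = inj₁ (0 , ≡.refl)
  parity (ℕ.suc n) with parity n
  ... | inj₁ (k , ≡.refl) = inj₂ (k , ≡.refl)
  ... | inj₂ (k , ≡.refl) = inj₁ (ℕ.suc k , ≡.cong ℕ.suc (≡.sym (ℕ.+-suc k (k ℕ.+ 0))))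

  odd-ℕ : ∀ k → + (1 ℕ.+ 2 ℕ.* k) ≡ odd k
  odd-ℕ k = ≡.cong (1ℤ +ᶻ_) (ℤ.pos-* 2 k)

  odd-not-even : ∀ k → ¬ 2 ∣ 1 ℕ.+ 2 ℕ.* k
  odd-not-even k 2∣1+2k = from-no (2 ∣? 1) (∣m+n∣m⇒∣n (≡.subst (2 ∣_) (ℕ.+-comm 1 (2 ℕ.* k)) 2∣1+2k) (m∣m*n k))

  value<1 : ∀ w → value w < 1#
  value<1 w = [ (λ w<1 → w<1) , ⊥-elim ∘ value≤1 w ]′ (irrational#ι (irrational w) 1ℤ)

  -- One step w ↦ t′ of the expansion, 1/w = a + e t′ with a = 2k + 1 and
  -- e = ±1; e = −1 requires a ≥ 3.
  record Digit (w : Ω) (a e : ℤ) (t′ : Carrier) : Set (ℓ₁ ⊔ˡ ℓ₂) where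
    field
      k        : ℕ
      a≡odd    : a ≡ odd k
      unit     : IsUnit e
      e≡-1⇒1≤k : e ≡ -1ℤ → 1 ℕ.≤ k
      1/w≈     : 1/ w ≈ ι a + ι e * t′

  -- The floor of 1/w is even exactly on D.
  digit : ∀ w → Digit w (a-D w) (e-D w) (value (T-D w))
  digit w with D? w | parity ⌊1/ w ⌋
  ... | yes w∈D | inj₂ (k , m≡) = ⊥-elim (odd-not-even k (≡.subst (2 ∣_) m≡ (D⇒even w w∈D)))
  ... | no  w∉D | inj₁ (k , m≡) = ⊥-elim (w∉D (even⇒D w (≡.subst (2 ∣_) (≡.sym m≡) (m∣m*n k))))
  ... | yes w∈D | inj₁ (k , m≡) = record
    { k = k
    ; a≡odd = ≡.trans (≡.cong (λ m → 1ℤ +ᶻ + m) m≡) (odd-ℕ k)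
    ; unit = inj₂ ≡.refl
    ; e≡-1⇒1≤k = λ _ → 1≤k k m≡
    ; 1/w≈ = sym (trans (+-congʳ (ι-+ 1ℤ (+ ⌊1/ w ⌋)))
        (solve 2 (λ y m → con 1ℤ :+ m :+ con -1ℤ :* (con 1ℤ :- (y :- m)) := y) refl (1/ w) (ι (+ ⌊1/ w ⌋))))
    }
    where
    1≤k : ∀ k → ⌊1/ w ⌋ ≡ 2 ℕ.* k → 1 ℕ.≤ k
    1≤k ℕ.zero    m≡0 = ⊥-elim (ℕ.≢-nonZero⁻¹ ⌊1/ w ⌋ {{k≢0 w}} m≡0)
    1≤k (ℕ.suc k) _   = ℕ.s≤s z≤n
  ... | no  w∉D | inj₂ (k , m≡) = record
    { k = k
    ; a≡odd = ≡.trans (≡.cong +_ m≡) (odd-ℕ k)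
    ; unit = inj₁ ≡.refl
    ; e≡-1⇒1≤k = λ ()
    ; 1/w≈ = solve 2 (λ y m → y := m :+ con 1ℤ :* (y :- m)) refl (1/ w) (ι (+ ⌊1/ w ⌋))
    }

  floor-unique : ∀ w n → ι (+ n) < 1/ w → 1/ w < ι (+ ℕ.suc n) → ⌊1/ w ⌋ ≡ n
  floor-unique w n n<1/w 1/w<1+n = ℕ.≤-antisym
    (ℕ.s≤s⁻¹ (ι-cancel-< w (<-trans (k<1/x w) 1/w<1+n)))
    (ℕ.s≤s⁻¹ (ι-cancel-< w (<-trans n<1/w (1/x<1+k w))))

  -- If 1/w = a + y with a odd and y in the admissible range, then a is the
  -- partial quotient of w: the floor of 1/w is a for y > 0, and the even
  -- number a − 1 for y < 0.
  digit-unique : ∀ w k {y} → value w * (ι (odd k) + y) ≈ 1# → DigitRange k y → a-D w ≡ odd k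
  digit-unique w k {y} w[a+y]≈1 range = a-D≡ range
    where
    1/w≈ : 1/ w ≈ ι (odd k) + y
    1/w≈ = cancel-# (inj₂ (0<value w))
      (trans (*-comm _ _) (trans (x*1/x≈1 w) (trans (sym w[a+y]≈1) (*-comm _ _))))
    a≈ : ι (+ (1 ℕ.+ 2 ℕ.* k)) ≈ ι (odd k)
    a≈ = reflexive (≡.cong ι (odd-ℕ k))
    from-odd-floor : ⌊1/ w ⌋ ≡ 1 ℕ.+ 2 ℕ.* k → a-D w ≡ odd k
    from-odd-floor m≡ with D? w
    ... | yes w∈D = ⊥-elim (odd-not-even k (≡.subst (2 ∣_) m≡ (D⇒even w w∈D)))
    ... | no  _   = ≡.trans (≡.cong +_ m≡) (odd-ℕ k)
    from-even-floor : ⌊1/ w ⌋ ≡ 2 ℕ.* k → a-D w ≡ odd k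
    from-even-floor m≡ with D? w
    ... | yes _   = ≡.trans (≡.cong (λ m → 1ℤ +ᶻ + m) m≡) (odd-ℕ k)
    ... | no  w∉D = ⊥-elim (w∉D (even⇒D w (≡.subst (2 ∣_) (≡.sym m≡) (m∣m*n k))))
    a-D≡ : DigitRange k y → a-D w ≡ odd k
    a-D≡ (inj₁ (0<y , y<1)) = from-odd-floor (floor-unique w _
      (<-by (trans (solve 2 (λ a y → y := a :+ y :- a) refl (ι (odd k)) y) (+-cong (sym 1/w≈) (-‿cong (sym a≈)))) 0<y)
      (<-by (trans (solve 2 (λ a y → con 1ℤ :- y := con 1ℤ :+ a :- (a :+ y)) refl (ι (odd k)) y)
        (+-cong (trans (+-congˡ (sym a≈)) (sym (ι-+ 1ℤ (+ (1 ℕ.+ 2 ℕ.* k))))) (-‿cong (sym 1/w≈)))) (<⇒0<- y<1)))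
    a-D≡ (inj₂ (-1<y , y<0 , _)) = from-even-floor (floor-unique w _
      (<-by (trans (solve 2 (λ b y → y :- con -1ℤ := con 1ℤ :+ b :+ y :- b) refl (ι (+ (2 ℕ.* k))) y)
        (+-congʳ (trans (+-congʳ (trans (sym (ι-+ 1ℤ (+ (2 ℕ.* k)))) a≈)) (sym 1/w≈)))) (<⇒0<- -1<y))
      (<-by (trans (solve 2 (λ a y → con 0ℤ :- y := a :- (a :+ y)) refl (ι (odd k)) y)
        (+-cong (sym a≈) (-‿cong (sym 1/w≈)))) (<⇒0<- y<0)))

  -- Convergents

  -- The n-th pair, with columns (pₙ₋₁, qₙ₋₁) and (pₙ, qₙ); n = 0 gives I.
  convergents : Ω → ℕ → Matrix
  convergents x n = matrix (p[ n -1] x) (p[ ℕ.suc n -1] x) (q[ n -1] x) (q[ ℕ.suc n -1] x)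

  -- eₙ tₙ, the tail of the n-th pair
  signed-tail : Ω → ℕ → Carrier
  signed-tail x n = ι (e x n) * value (t x n)

  e-unit : ∀ x n → IsUnit (e x n)
  e-unit x ℕ.zero    = inj₁ ≡.refl
  e-unit x (ℕ.suc n) = Digit.unit (digit (t x n))

  signed-tail-step : ∀ x n → signed-tail x n * (ι (a x (ℕ.suc n)) + signed-tail x (ℕ.suc n)) ≈ ι (e x n)
  signed-tail-step x n = trans (*-assoc _ _ _)
    (trans (*-congˡ (trans (*-congˡ (sym (Digit.1/w≈ (digit (t x n))))) (x*1/x≈1 (t x n)))) (*-identityʳ _))

  convergents-tail : ∀ x n → Tail (convergents x n) (value x) (signed-tail x n)
  convergents-tail x ℕ.zero =
    solve 1 (λ x → con 1ℤ :* x :* (:- con 0ℤ :* x :+ con 1ℤ) := con 1ℤ :* x :- con 0ℤ) refl (value x)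
  convergents-tail x (ℕ.suc n) =
    tail-step (convergents x n) (e x n) (a x (ℕ.suc n)) (signed-tail-step x n) (convergents-tail x n)

  next-range : ∀ w → DigitRange (Digit.k (digit w)) (ι (e-D w) * value (T-D w))
  next-range w = range (Digit.unit d) (Digit.e≡-1⇒1≤k d)
    where
    d : Digit w (a-D w) (e-D w) (value (T-D w))
    d = digit w
    v : Carrier
    v = value (T-D w)
    range : ∀ {e} → IsUnit e → (e ≡ -1ℤ → 1 ℕ.≤ Digit.k d) → DigitRange (Digit.k d) (ι e * v)
    range (inj₁ ≡.refl) _ = inj₁
      (<-respʳ (sym (*-identityˡ v)) (0<value (T-D w)) , <-respˡ (sym (*-identityˡ v)) (value<1 (T-D w)))
    range (inj₂ ≡.refl) 1≤k = inj₂
      ( <-respʳ (-x≈-1*x v) (neg-mono-< (value<1 (T-D w)))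
      , <-respˡ (-x≈-1*x v) (neg-pos (0<value (T-D w)))
      , 1≤k ≡.refl)

  convergents-first : ∀ x → convergents x 1 ≡ matrix 0ℤ 1ℤ 1ℤ (a x 1)
  convergents-first x = matrix-cong ≡.refl (identity₁ (a x 1)) ≡.refl (identity₂ (a x 1))
    where
    identity₁ : ∀ a → a *ᶻ 0ℤ +ᶻ 1ℤ *ᶻ 1ℤ ≡ 1ℤ
    identity₁ = solve-∀
    identity₂ : ∀ a → a *ᶻ 1ℤ +ᶻ 1ℤ *ᶻ 0ℤ ≡ a
    identity₂ = solve-∀

  first-range : ∀ k {y} → DigitRange k y → Range (matrix 0ℤ 1ℤ 1ℤ (odd k)) y
  first-range _ (inj₁ 0<y<1) = inj₁ 0<y<1
  first-range (ℕ.suc k) (inj₂ (-1<y , y<0 , _)) = inj₂ (-1<y , y<0 ,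
    <-by (trans (solve 2 (λ g k → k :* con (+ 2) :+ (con 1ℤ :- g)
                           := con 1ℤ :+ con (+ 2) :* (con 1ℤ :+ k) :- (con (+ 2) :+ g) :* con 1ℤ) refl g (ι (+ k)))
           (+-congʳ (sym (ι-odd-suc k))))
      (nonneg-combination k (ι-pos 1) 0<1-g))

  convergents-admissible : ∀ x n → Admissible (convergents x (ℕ.suc n)) (value x) (signed-tail x (ℕ.suc n))
  convergents-admissible x ℕ.zero = ≡.subst (λ M → Admissible M (value x) (signed-tail x 1)) (≡.sym first≡) (record
    { reduced = reduced-first k
    ; gQ<Q′   = <-by (trans (solve 2 (λ g k → k :* con (+ 2) :+ (con 1ℤ :- g)
                                     := con 1ℤ :+ con (+ 2) :* k :- g :* con 1ℤ) refl g (ι (+ k)))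
                       (+-congʳ (sym (ι-odd k))))
                  (nonneg-combination k (ι-pos 1) 0<1-g)
    ; tail    = ≡.subst (λ M → Tail M (value x) (signed-tail x 1)) first≡ (convergents-tail x 1)
    ; range   = first-range k (next-range x)
    })
    where
    k : ℕ
    k = Digit.k (digit x)
    first≡ : convergents x 1 ≡ matrix 0ℤ 1ℤ 1ℤ (odd k)
    first≡ = ≡.trans (convergents-first x) (≡.cong (matrix 0ℤ 1ℤ 1ℤ) (Digit.a≡odd (digit x)))
  convergents-admissible x (ℕ.suc n) =
    ≡.subst (λ a → Admissible (step (e x m) a (convergents x m)) (value x) (signed-tail x (ℕ.suc m)))
      (≡.sym (Digit.a≡odd d))
      (admissible-step (Digit.k d) (e-unit x m) (convergents-admissible x n)
        (≡.subst (λ a → signed-tail x m * (ι a + signed-tail x (ℕ.suc m)) ≈ ι (e x m))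
          (Digit.a≡odd d) (signed-tail-step x m))
        negative (next-range (t x m)))
    where
    m : ℕ
    m = ℕ.suc n
    d : Digit (t x m) (a-D (t x m)) (e-D (t x m)) (value (T-D (t x m)))
    d = digit (t x m)
    negative : e x m ≡ -1ℤ → signed-tail x m < 0#
    negative e≡-1 = <-respˡ (trans (-x≈-1*x _) (*-congʳ (reflexive (≡.cong ι (≡.sym e≡-1)))))
      (neg-pos (0<value (t x m)))

  -- A number e r with e = ±1 and r > 0 determines e and r.
  sign-modulus-unique : ∀ {e e′ r r′} → IsUnit e → IsUnit e′ → 0# < r → 0# < r′ →
                        ι e * r ≈ ι e′ * r′ → e ≡ e′ × r ≈ r′
  sign-modulus-unique (inj₁ ≡.refl) (inj₁ ≡.refl) _ _ eq =
    ≡.refl , trans (sym (*-identityˡ _)) (trans eq (*-identityˡ _))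
  sign-modulus-unique (inj₂ ≡.refl) (inj₂ ≡.refl) _ _ eq =
    ≡.refl , trans (strip _) (trans (-‿cong eq) (sym (strip _)))
    where
    strip : ∀ r → r ≈ - (ι -1ℤ * r)
    strip = solve 1 (λ r → r := :- (con -1ℤ :* r)) refl
  sign-modulus-unique (inj₁ ≡.refl) (inj₂ ≡.refl) 0<r 0<r′ eq = ⊥-elim (<-asym 0<r
    (<-respˡ (trans (-x≈-1*x _) (trans (sym eq) (*-identityˡ _))) (neg-pos 0<r′)))
  sign-modulus-unique (inj₂ ≡.refl) (inj₁ ≡.refl) 0<r 0<r′ eq = ⊥-elim (<-asym 0<r′
    (<-respˡ (trans (-x≈-1*x _) (trans eq (*-identityˡ _))) (neg-pos 0<r)))

  -- Descent on Q + Q′, bounded by N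
  admissible⇒convergents : ∀ x N M {y} → Admissible M (value x) y → Matrix.Q M +ᶻ Matrix.Q′ M ≤ᶻ + N →
                           ∃[ n ] M ≡ convergents x (ℕ.suc n)
  admissible⇒convergents x N M@(matrix P P′ Q Q′) {y} adm Q+Q′≤N
    with 0≡⊎1≤ (Reduced.0≤P (Admissible.reduced adm))
  admissible⇒convergents x N M@(matrix P P′ Q Q′) {y} adm Q+Q′≤N | inj₁ ≡.refl
    with P≡0⇒first (Admissible.reduced adm)
  ... | ≡.refl , ≡.refl , k , ≡.refl = 0 , ≡.sym (≡.trans (convergents-first x) (≡.cong (matrix 0ℤ 1ℤ 1ℤ) a≡))
    where
    x[a+y]≈1 : value x * (ι (odd k) + y) ≈ 1#
    x[a+y]≈1 = trans (solve 3 (λ x a y → x :* (a :+ y)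
                     := con 1ℤ :+ (a :* x :- con 1ℤ) :- y :* (:- con 1ℤ :* x :+ con 0ℤ)) refl (value x) (ι (odd k)) y)
      (trans (+-congˡ (-‿cong (Admissible.tail adm)))
      (solve 2 (λ x a → con 1ℤ :+ (a :* x :- con 1ℤ) :- (a :* x :- con 1ℤ) := con 1ℤ) refl (value x) (ι (odd k))))
    first-digit-range : ∀ k → Range (matrix 0ℤ 1ℤ 1ℤ (odd k)) y → DigitRange k y
    first-digit-range _ (inj₁ 0<y<1) = inj₁ 0<y<1
    first-digit-range (ℕ.suc k) (inj₂ (-1<y , y<0 , _)) = inj₂ (-1<y , y<0 , ℕ.s≤s z≤n)
    first-digit-range ℕ.zero (inj₂ (-1<y , y<0 , 2+g<1)) = ⊥-elim (<-asym 2+g<1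
      (<-by (solve 1 (λ g → con 1ℤ :+ g := (con (+ 2) :+ g) :* con 1ℤ :- con 1ℤ) refl g) 0<1+g))
    a≡ : a x 1 ≡ odd k
    a≡ = digit-unique x k x[a+y]≈1 (first-digit-range k (Admissible.range adm))
  admissible⇒convergents x ℕ.zero M@(matrix P P′ Q Q′) adm Q+Q′≤0 | inj₂ 1≤P =
    ⊥-elim (0≰-1 (identity Q Q′) (0≤+ (0≤+ (diff Q+Q′≤0) (diff 1≤Q)) 0≤Q′))
    where
    open Reduced (Admissible.reduced adm)
    identity : ∀ Q Q′ → 0ℤ -ᶻ (Q +ᶻ Q′) +ᶻ (Q -ᶻ 1ℤ) +ᶻ Q′ ≡ -1ℤ
    identity = solve-∀
  admissible⇒convergents x (ℕ.suc N) M@(matrix P P′ Q Q′) adm Q+Q′≤N | inj₂ 1≤P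
    = next (admissible⇒convergents x N (unstepᴹ e⁻ (odd k) M) admissible smaller)
    where
    open Predecessor (predecessor adm 1≤P) renaming (digit to next-digit)
    Q⁻ : ℤ
    Q⁻ = unstep e⁻ (odd k) Q Q′
    identity : ∀ N Q Q′ Q⁻ → 1ℤ +ᶻ N -ᶻ (Q +ᶻ Q′) +ᶻ (Q′ -ᶻ (Q⁻ +ᶻ 1ℤ)) ≡ N -ᶻ (Q⁻ +ᶻ Q)
    identity = solve-∀
    smaller : Q⁻ +ᶻ Q ≤ᶻ + N
    smaller = undiff (0≤-cong (identity (+ N) Q Q′ Q⁻) (0≤+ (diff Q+Q′≤N) (diff Q⁻<Q′)))
    next : ∃[ n ] unstepᴹ e⁻ (odd k) M ≡ convergents x (ℕ.suc n) → ∃[ n ] M ≡ convergents x (ℕ.suc n)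
    next (n , M⁻≡) = ℕ.suc n ,
      ≡.trans (step-unstepᴹ unit (odd k) M) (≡.cong₂ (λ f N → f N) (≡.cong₂ step (≡.sym e≡) (≡.sym a≡)) M⁻≡)
      where
      GL₂ : unstepᴹ e⁻ (odd k) M ∈GL₂[ℤ]
      GL₂ = det-unit⇒GL₂ _ (Reduced.det-unit (Admissible.reduced admissible))
      same : e x (ℕ.suc n) ≡ e⁻ × value (t x (ℕ.suc n)) ≈ r
      same = sign-modulus-unique (e-unit x (ℕ.suc n)) unit (0<value (t x (ℕ.suc n))) 0<r
        (tail-unique (unstepᴹ e⁻ (odd k) M) GL₂ (irrational x)
          (≡.subst (λ N → Tail N (value x) (signed-tail x (ℕ.suc n))) (≡.sym M⁻≡) (convergents-tail x (ℕ.suc n)))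
          (Admissible.tail admissible))
      e≡ : e x (ℕ.suc n) ≡ e⁻
      e≡ = proj₁ same
      a≡ : a x (ℕ.suc (ℕ.suc n)) ≡ odd k
      a≡ = digit-unique (t x (ℕ.suc n)) k (trans (*-congʳ (proj₂ same)) r[a+y]≈1) next-digit

  successive⇒condition : ∀ {P Q P′ Q′} x → SuccessiveConvergents P Q P′ Q′ x →
                         Σ[ r ∈ 𝓡ₒ (matrix P P′ Q Q′) ] (Condition∗ r x ⊎ Condition∗∗ r x)
  successive⇒condition x (ℕ.suc n , _ , ≡.refl , ≡.refl , ≡.refl , ≡.refl) =
    admissible⇒condition x (convergents-admissible x n)

  condition⇒successive : ∀ {P Q P′ Q′} x → Σ[ r ∈ 𝓡ₒ (matrix P P′ Q Q′) ] (Condition∗ r x ⊎ Condition∗∗ r x) →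
                         SuccessiveConvergents P Q P′ Q′ x
  condition⇒successive {P} {Q} {P′} {Q′} x (r , condition)
    with admissible⇒convergents x ∣ Q +ᶻ Q′ ∣ (matrix P P′ Q Q′) (condition⇒admissible r x condition)
           (ℤ.≤-reflexive (≡.sym (ℤ.0≤i⇒+∣i∣≡i (0≤+ 0≤Q 0≤Q′))))
    where open Reduced (𝓡ₒ⇒reduced r)
  ... | n , ≡.refl = ℕ.suc n , ℕ.s≤s z≤n , ≡.refl , ≡.refl , ≡.refl , ≡.refl

proposition3p4 : ∀ {c ℓ₁ ℓ₂} (R : Reals c ℓ₁ ℓ₂) → let open OCF R in
    (P Q P′ Q′ : ℤ) (x : Ω) →
    SuccessiveConvergents P Q P′ Q′ x ⇔
    (Σ[ M∈𝓡ₒ ∈ 𝓡ₒ (matrix P P′ Q Q′) ] (Condition∗ M∈𝓡ₒ x ⊎ Condition∗∗ M∈𝓡ₒ x))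
proposition3p4 R P Q P′ Q′ x = mk⇔ (successive⇒condition R x) (condition⇒successive R x)
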